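{- For every positive integer $s$, as formal power series in $y$, \[ FC_{2}(s,y)=-\frac{y\,\frac{d}{dy}Q_s(y)}{Q_s(y)}+s+1 . \]
   Context: Definition of the counting function. The pseudo-cycle graph $C_{n,2}$ has $n$ vertices $v_1,\dots,v_n$ arranged in a cycle with $2$ self-loops at each vertex. A magic labelling with magic sum $s$ assigns a nonnegative integer to each edge (including loops) so that at each vertex the labels of incident edges (each loop counted once) sum to $s$. Explicitly, for $n\ge1$ and $s\in\mathbb{N}$, $h_{C_{n,2}}(s)$ is the number of nonnegative integer tuples $(\beta_1,\dots,\beta_n;\alpha_{i,1},\alpha_{i,2}\ (1\le i\le n))$ with $\beta_i+\alpha_{i,1}+\alpha_{i,2}+\beta_{i+1}=s$ for all $1\le i\le n$, where $\beta_{n+1}=\beta_1$ (so for $n=1$ the single condition is $2\beta_1+\alpha_{1,1}+\alpha_{1,2}=s$, and for $n=2$ there are two parallel edges between the two vertices). By convention $h_{C_{0,2}}(s)=s+1$. Set \[ FC_2(s,y)=\sum_{n=0}^{\infty}h_{C_{n,2}}(s)\,y^n . \] Definition of the polynomials. For $n\ge 4$, \[ Q_n(y)=-y[Q_{n-1}(-y)+Q_{n-3}(-y)]+2Q_{n-2}(y)-Q_{n-4}(y), \] with $Q_0(y)=1-y$, $Q_1(y)=1-2y-y^2$, $Q_2(y)=1-4y-2y^2+y^3$, $Q_3(y)=1-6y-7y^2+2y^3+y^4$. -}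

module Defs where

open import Data.Fin.Base using (Fin; zero; suc; toℕ)
open import Data.Fin.Properties using (all?)
open import Data.Integer.Base as ℤ using (ℤ; +_; 0ℤ; 1ℤ)
import Data.Integer.Properties as ℤ
open import Data.Integer.Tactic.RingSolver using (solve-∀)
open import Data.List.Base
  using (List; []; _∷_; length; filter; upTo; cartesianProduct; cartesianProductWith)
open import Data.List.Membership.Propositional using (_∈_)
open import Data.List.Membership.Propositional.Properties
  using (∈-filter⁺; ∈-filter⁻; ∈-cartesianProduct⁺; ∈-cartesianProductWith⁺; ∈-upTo⁺)
open import Data.List.Relation.Unary.All using ([])
open import Data.List.Relation.Unary.Any using (here)
open import Data.List.Relation.Unary.AllPairs using ([]; _∷_)
open import Data.List.Relation.Unary.Unique.Propositional using (Unique)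
import Data.List.Relation.Unary.Unique.Propositional.Properties as Unique
open import Data.Nat.Base as ℕ using (ℕ; zero; suc; NonZero; _≤_; s≤s)
open import Data.Nat.DivMod using (_mod_)
import Data.Nat.Properties as ℕ
open import Data.Product.Base using (_×_; _,_; proj₂)
open import Data.Vec.Base using (Vec; []; _∷_; lookup)
open import Data.Vec.Properties using (∷-injective)
open import Function.Bundles using (_⇔_; mk⇔)
open import Relation.Binary.PropositionalEquality
open import Relation.Unary using (Decidable)

------------------------------------------------------------------------
-- Magic labellings of the pseudo-cycle graph

-- (β , α₁ , α₂): the cycle edges, and the first and second loops, with
-- the vertices v₁, …, vₙ indexed from 0 by Fin n.
Labelling : ℕ → Set
Labelling n = Vec ℕ n × Vec ℕ n × Vec ℕ n

module _ (n : ℕ) .{{_ : NonZero n}} where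

  next : Fin n → Fin n
  next i = suc (toℕ i) mod n

  IsMagic : ℕ → Labelling n → Set
  IsMagic s (β , α₁ , α₂) = ∀ (i : Fin n) →
    lookup β i ℕ.+ lookup α₁ i ℕ.+ lookup α₂ i ℕ.+ lookup β (next i) ≡ s

  isMagic? : ∀ s → Decidable (IsMagic s)
  isMagic? s (β , α₁ , α₂) = all? λ i →
    lookup β i ℕ.+ lookup α₁ i ℕ.+ lookup α₂ i ℕ.+ lookup β (next i) ℕ.≟ s

vecs : ∀ {A : Set} → List A → (n : ℕ) → List (Vec A n)
vecs xs zero    = [] ∷ []
vecs xs (suc n) = cartesianProductWith _∷_ xs (vecs xs n)

labellingsUpTo : ℕ → (n : ℕ) → List (Labelling n)
labellingsUpTo s n = cartesianProduct vs (cartesianProduct vs vs)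
  where vs = vecs (upTo (suc s)) n

-- Every label of a magic labelling of sum s is at most s, so searching
-- among the labels 0, …, s misses nothing; see ∈-magicLabellings and
-- magicLabellings-unique below.
magicLabellings : ∀ n .{{_ : NonZero n}} → ℕ → List (Labelling n)
magicLabellings n s = filter (isMagic? n s) (labellingsUpTo s n)

-- The value s + 1 at n = 0 is a convention, not a count.
h : ℕ → ℕ → ℕ
h zero      s = suc s
h n@(suc _) s = length (magicLabellings n s)

private
  vecs-unique : ∀ {A : Set} {xs : List A} → Unique xs → ∀ n → Unique (vecs xs n)
  vecs-unique xs! zero    = [] ∷ []
  vecs-unique xs! (suc n) =
    Unique.cartesianProductWith⁺ _∷_ ∷-injective xs! (vecs-unique xs! n)

  ∈-vecs : ∀ {A : Set} {xs : List A} {n} (v : Vec A n) →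
           (∀ i → lookup v i ∈ xs) → v ∈ vecs xs n
  ∈-vecs []      _ = here refl
  ∈-vecs (x ∷ v) p =
    ∈-cartesianProductWith⁺ _∷_ (p zero) (∈-vecs v (λ i → p (suc i)))

  first≤ : ∀ a b c d → a ≤ a ℕ.+ b ℕ.+ c ℕ.+ d
  first≤ a b c d = ℕ.m≤n⇒m≤n+o d (ℕ.m≤n⇒m≤n+o c (ℕ.m≤m+n a b))

  second≤ : ∀ a b c d → b ≤ a ℕ.+ b ℕ.+ c ℕ.+ d
  second≤ a b c d = ℕ.m≤n⇒m≤n+o d (ℕ.m≤n⇒m≤n+o c (ℕ.m≤n+m b a))

  third≤ : ∀ a b c d → c ≤ a ℕ.+ b ℕ.+ c ℕ.+ d
  third≤ a b c d = ℕ.m≤n⇒m≤n+o d (ℕ.m≤n+m c (a ℕ.+ b))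

magicLabellings-unique : ∀ n .{{_ : NonZero n}} s → Unique (magicLabellings n s)
magicLabellings-unique n s =
  Unique.filter⁺ (isMagic? n s) (Unique.cartesianProduct⁺ vs! (Unique.cartesianProduct⁺ vs! vs!))
  where vs! = vecs-unique (Unique.upTo⁺ (suc s)) n

∈-magicLabellings : ∀ n .{{_ : NonZero n}} s (l : Labelling n) →
                    l ∈ magicLabellings n s ⇔ IsMagic n s l
∈-magicLabellings n s l@(β , α₁ , α₂) = mk⇔
  (λ l∈ → proj₂ (∈-filter⁻ (isMagic? n s) {xs = labellingsUpTo s n} l∈))
  (λ magic → ∈-filter⁺ (isMagic? n s)
    (∈-cartesianProduct⁺ (in-range magic β λ i → first≤ (lookup β i) _ _ _)
      (∈-cartesianProduct⁺ (in-range magic α₁ λ i → second≤ (lookup β i) _ _ _)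
                           (in-range magic α₂ λ i → third≤ (lookup β i) _ _ _)))
    magic)
  where
  in-range : IsMagic n s l → (v : Vec ℕ n) →
             (∀ i → lookup v i ≤
                lookup β i ℕ.+ lookup α₁ i ℕ.+ lookup α₂ i ℕ.+ lookup β (next n i)) →
             v ∈ vecs (upTo (suc s)) n
  in-range magic v bound = ∈-vecs v λ i →
    ∈-upTo⁺ (s≤s (subst (lookup v i ≤_) (magic i) (bound i)))

------------------------------------------------------------------------
-- Polynomials and formal power series over ℤ

-- Coefficients, constant term first; trailing zeros are allowed.
Poly : Set
Poly = List ℤ

infixl 6 _+ᴾ_ _-ᴾ_
infixr 7 _∙ᴾ_

_+ᴾ_ : Poly → Poly → Poly
[]      +ᴾ q       = q
p       +ᴾ []      = p
(a ∷ p) +ᴾ (b ∷ q) = (a ℤ.+ b) ∷ (p +ᴾ q)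

_∙ᴾ_ : ℤ → Poly → Poly
c ∙ᴾ []      = []
c ∙ᴾ (a ∷ p) = (c ℤ.* a) ∷ (c ∙ᴾ p)

-ᴾ_ : Poly → Poly
-ᴾ p = ℤ.-1ℤ ∙ᴾ p

_-ᴾ_ : Poly → Poly → Poly
p -ᴾ q = p +ᴾ (-ᴾ q)

y*ᴾ_ : Poly → Poly
y*ᴾ p = 0ℤ ∷ p

-- p(y) ↦ p(-y): if p(y) = a + y r(y) then p(-y) = a - y r(-y).
_⟨-y⟩ : Poly → Poly
[]      ⟨-y⟩ = []
(a ∷ p) ⟨-y⟩ = a ∷ (-ᴾ (p ⟨-y⟩))

-- A series is its sequence of coefficients; series are compared with _≗_.
Series : Set
Series = ℕ → ℤ

⟦_⟧ : Poly → Series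
⟦ []    ⟧ _       = 0ℤ
⟦ a ∷ p ⟧ zero    = a
⟦ a ∷ p ⟧ (suc n) = ⟦ p ⟧ n

infixl 6 _⊕_
infixl 7 _⊗_
infix  8 ⊖_

_⊕_ : Series → Series → Series
(f ⊕ g) n = f n ℤ.+ g n

⊖_ : Series → Series
(⊖ f) n = ℤ.- f n

const : ℤ → Series
const c = ⟦ c ∷ [] ⟧

y*_ : Series → Series
(y* f) zero    = 0ℤ
(y* f) (suc n) = f n

d/dy : Series → Series
d/dy f n = + suc n ℤ.* f (suc n)

tail : Series → Series
tail f n = f (suc n)

-- The Cauchy product, unfolded along f = f₀ + y (tail f).
_⊗_ : Series → Series → Series
(f ⊗ g) zero    = f 0 ℤ.* g 0
(f ⊗ g) (suc n) = f 0 ℤ.* g (suc n) ℤ.+ (tail f ⊗ g) n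

-- The quotient f / g for g with constant term 1, by long division:
-- f / g = f₀ + y ((f - f₀ g) / y) / g.  It is characterised by divide-⊗
-- and divide-unique below.
divide : (f g : Series) → g 0 ≡ 1ℤ → Series
divide f g g₀≡1 zero    = f 0
divide f g g₀≡1 (suc n) = divide (λ k → f (suc k) ℤ.- f 0 ℤ.* g (suc k)) g g₀≡1 n

private
  cancel : ∀ a b → a ℤ.+ (b ℤ.- a) ≡ b
  cancel = solve-∀

  cancel′ : ∀ a b → (a ℤ.+ b) ℤ.- a ≡ b
  cancel′ = solve-∀

  divide-cong : ∀ {f f′} g g₀≡1 → f ≗ f′ → divide f g g₀≡1 ≗ divide f′ g g₀≡1
  divide-cong g g₀≡1 eq zero    = eq 0
  divide-cong g g₀≡1 eq (suc n) = divide-cong g g₀≡1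
    (λ k → cong₂ (λ a b → a ℤ.- b ℤ.* g (suc k)) (eq (suc k)) (eq 0)) n

divide-⊗ : ∀ f g g₀≡1 → divide f g g₀≡1 ⊗ g ≗ f
divide-⊗ f g g₀≡1 zero    = trans (cong (f 0 ℤ.*_) g₀≡1) (ℤ.*-identityʳ (f 0))
divide-⊗ f g g₀≡1 (suc n) = trans
  (cong (λ z → f 0 ℤ.* g (suc n) ℤ.+ z)
    (divide-⊗ (λ k → f (suc k) ℤ.- f 0 ℤ.* g (suc k)) g g₀≡1 n))
  (cancel (f 0 ℤ.* g (suc n)) (f (suc n)))

divide-unique : ∀ q f g g₀≡1 → q ⊗ g ≗ f → q ≗ divide f g g₀≡1
divide-unique q f g g₀≡1 eq = go
  where
  q₀≡f₀ : q 0 ≡ f 0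
  q₀≡f₀ = trans (sym (trans (cong (q 0 ℤ.*_) g₀≡1) (ℤ.*-identityʳ (q 0)))) (eq 0)

  go : q ≗ divide f g g₀≡1
  go zero    = q₀≡f₀
  go (suc n) = divide-unique (tail q) _ g g₀≡1
    (λ k → trans (sym (cancel′ (q 0 ℤ.* g (suc k)) ((tail q ⊗ g) k)))
      (cong₂ (λ a b → a ℤ.- b ℤ.* g (suc k)) (eq (suc k)) q₀≡f₀)) n

------------------------------------------------------------------------
-- The polynomials Q and the generating function FC₂

Q : ℕ → Poly
Q 0 = + 1 ∷ ℤ.- + 1 ∷ []
Q 1 = + 1 ∷ ℤ.- + 2 ∷ ℤ.- + 1 ∷ []
Q 2 = + 1 ∷ ℤ.- + 4 ∷ ℤ.- + 2 ∷ + 1 ∷ []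
Q 3 = + 1 ∷ ℤ.- + 6 ∷ ℤ.- + 7 ∷ + 2 ∷ + 1 ∷ []
Q (suc n-1@(suc n-2@(suc n-3@(suc n-4)))) =
  (-ᴾ (y*ᴾ (Q n-1 ⟨-y⟩ +ᴾ Q n-3 ⟨-y⟩))) +ᴾ (+ 2 ∙ᴾ Q n-2) -ᴾ Q n-4

private
  +ᴾ-const : ∀ p q → ⟦ p +ᴾ q ⟧ 0 ≡ ⟦ p ⟧ 0 ℤ.+ ⟦ q ⟧ 0
  +ᴾ-const []      q       = sym (ℤ.+-identityˡ _)
  +ᴾ-const (a ∷ p) []      = sym (ℤ.+-identityʳ _)
  +ᴾ-const (a ∷ p) (b ∷ q) = refl

  ∙ᴾ-const : ∀ c p → ⟦ c ∙ᴾ p ⟧ 0 ≡ c ℤ.* ⟦ p ⟧ 0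
  ∙ᴾ-const c []      = sym (ℤ.*-zeroʳ c)
  ∙ᴾ-const c (a ∷ p) = refl

Q-constant-term : ∀ s → ⟦ Q s ⟧ 0 ≡ 1ℤ
Q-constant-term 0 = refl
Q-constant-term 1 = refl
Q-constant-term 2 = refl
Q-constant-term 3 = refl
Q-constant-term (suc n-1@(suc n-2@(suc n-3@(suc n-4)))) = begin
  ⟦ A +ᴾ B -ᴾ Q n-4 ⟧ 0                         ≡⟨ +ᴾ-const (A +ᴾ B) (-ᴾ Q n-4) ⟩
  ⟦ A +ᴾ B ⟧ 0 ℤ.+ ⟦ -ᴾ Q n-4 ⟧ 0               ≡⟨ cong₂ ℤ._+_ (+ᴾ-const A B) (∙ᴾ-const ℤ.-1ℤ (Q n-4)) ⟩
  0ℤ ℤ.+ ⟦ B ⟧ 0 ℤ.+ ℤ.-1ℤ ℤ.* ⟦ Q n-4 ⟧ 0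
    ≡⟨ cong₂ (λ a b → 0ℤ ℤ.+ a ℤ.+ ℤ.-1ℤ ℤ.* b)
         (trans (∙ᴾ-const (+ 2) (Q n-2)) (cong (+ 2 ℤ.*_) (Q-constant-term n-2)))
         (Q-constant-term n-4) ⟩
  1ℤ                                          ∎
  where
  open ≡-Reasoning
  A = -ᴾ (y*ᴾ (Q n-1 ⟨-y⟩ +ᴾ Q n-3 ⟨-y⟩))
  B = + 2 ∙ᴾ Q n-2

FC₂ : ℕ → Series
FC₂ s n = + h n s

{-# OPTIONS --safe #-}
module Submission where

-- Eliminating the loops, h counts closed walks: it is the trace of Tⁿ, where
-- T is the matrix of size m = s + 1 with entries (m − a − b)⁺.  So FC₂ is the
-- trace of (1 − y T)⁻¹, and Q s should be q_m = det (1 − y T).  No determinants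
-- are needed: cutting closed walks at their visits to 0 shows that removing the
-- index 0 changes the trace by 1 + θp / p, where θ = y d/dy and p is the entry
-- (0 , 0) of (1 − y T)⁻¹.  What remains of T is the matrix of size m − 2 and an
-- isolated index, while p = q_{m−2} / q_m because an explicit polynomial vector
-- solves (1 − y T) v = q_m e₀ with v₀ = q_{m−2}.  The formula follows by
-- induction in steps of two.

open import Defs
open import Data.Bool.Base using (true; false; if_then_else_; _∧_)
open import Data.Fin.Base using (Fin; zero; suc; toℕ; fromℕ; inject₁)
import Data.Fin.Properties as Fin
open import Data.Fin.Relation.Unary.Top using (view; ‵fromℕ; ‵inject₁)
open import Data.Integer.Base using (ℤ; +_; _+_; _*_; -_; _-_; 0ℤ; 1ℤ; -1ℤ)
import Data.Integer.Properties as ℤ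
open import Data.Integer.Tactic.RingSolver using (solve-∀)
open import Data.List.Base as List
  using (List; []; _∷_; length; filter; upTo; applyUpTo; cartesianProductWith; cartesianProduct)
open import Data.Nat.Base as ℕ using (ℕ; zero; suc; NonZero; _<_; _∸_; s≤s; s<s⁻¹)
open import Data.Nat.DivMod using (n%n≡0; m<n⇒m%n≡m)
import Data.Nat.Properties as ℕ
import Data.Nat.Tactic.RingSolver as ℕ-Solver
open import Data.Product.Base using (_,_)
open import Data.Vec.Base using (Vec; []; _∷_; lookup; _∷ʳ_)
open import Function.Base using (_∘_)
open import Function.Bundles using (mk⇔)
open import Relation.Binary.PropositionalEquality
open import Relation.Nullary.Decidable using (Dec; does; does-⇔; dec-true; _×-dec_)
open import Relation.Unary using (Decidable)
open import Algebra.Properties.Semiring.Sum ℤ.+-*-semiring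
  using (sum; sum-cong-≗; ∑-distrib-+; ∑-comm; sum-replicate-zero; *-distribˡ-sum; *-distribʳ-sum)
open ≡-Reasoning

-- Sums and the ring of power series

∑ : ℕ → (ℕ → ℤ) → ℤ
∑ m f = sum {m} (f ∘ toℕ)

∑-cong : ∀ m {f g} → (∀ i → i < m → f i ≡ g i) → ∑ m f ≡ ∑ m g
∑-cong m eq = sum-cong-≗ {m} (λ i → eq (toℕ i) (Fin.toℕ<n i))

∑-zero : ∀ m {f} → (∀ i → f i ≡ 0ℤ) → ∑ m f ≡ 0ℤ
∑-zero m eq = trans (∑-cong m (λ i _ → eq i)) (sum-replicate-zero m)

∑-last : ∀ m f → ∑ (suc m) f ≡ ∑ m f + f m
∑-last zero    f = ℤ.+-comm (f 0) 0ℤ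
∑-last (suc m) f = trans (cong (_+_ (f 0)) (∑-last m (f ∘ suc))) (sym (ℤ.+-assoc (f 0) _ _))

-- The Boolean test makes this definitionally the indicator of `a ≟ b`, which `indicator-all` relies
-- on.
δ : ℕ → ℕ → ℤ
δ a b = if a ℕ.≡ᵇ b then 1ℤ else 0ℤ

δ-refl : ∀ a → δ a a ≡ 1ℤ
δ-refl zero    = refl
δ-refl (suc a) = δ-refl a

δ-sym : ∀ a b → δ a b ≡ δ b a
δ-sym zero    zero    = refl
δ-sym zero    (suc b) = refl
δ-sym (suc a) zero    = refl
δ-sym (suc a) (suc b) = δ-sym a b

∑-δ : ∀ m a (f : ℕ → ℤ) → a < m → ∑ m (λ c → δ a c * f c) ≡ f a
∑-δ (suc m) zero    f _   = trans
  (cong₂ _+_ (ℤ.*-identityˡ (f 0)) (∑-zero m (λ c → ℤ.*-zeroˡ (f (suc c)))))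
  (ℤ.+-identityʳ (f 0))
∑-δ (suc m) (suc a) f a<m = trans
  (cong₂ _+_ (ℤ.*-zeroˡ (f 0)) (∑-δ m a (f ∘ suc) (s<s⁻¹ a<m)))
  (ℤ.+-identityˡ (f (suc a)))

scale : ℤ → Series → Series
scale c f n = c * f n

⊗-cong : ∀ {f f′ g g′} → f ≗ f′ → g ≗ g′ → f ⊗ g ≗ f′ ⊗ g′
⊗-cong eq eq′ zero    = cong₂ _*_ (eq 0) (eq′ 0)
⊗-cong eq eq′ (suc n) =
  cong₂ _+_ (cong₂ _*_ (eq 0) (eq′ (suc n))) (⊗-cong (eq ∘ suc) eq′ n)

⊗-distribˡ : ∀ f g h → f ⊗ (g ⊕ h) ≗ f ⊗ g ⊕ f ⊗ h
⊗-distribˡ f g h zero    = ℤ.*-distribˡ-+ (f 0) (g 0) (h 0)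
⊗-distribˡ f g h (suc n) = trans
  (cong (λ z → f 0 * (g (suc n) + h (suc n)) + z) (⊗-distribˡ (tail f) g h n))
  (lemma (f 0) (g (suc n)) (h (suc n)) _ _)
  where
  lemma : ∀ a b c d e → a * (b + c) + (d + e) ≡ a * b + d + (a * c + e)
  lemma = solve-∀

⊗-scaleˡ : ∀ c f g → scale c f ⊗ g ≗ scale c (f ⊗ g)
⊗-scaleˡ c f g zero    = ℤ.*-assoc c (f 0) (g 0)
⊗-scaleˡ c f g (suc n) = trans
  (cong (_+_ (c * f 0 * g (suc n))) (⊗-scaleˡ c (tail f) g n))
  (lemma c (f 0) (g (suc n)) _)
  where
  lemma : ∀ c a b d → c * a * b + c * d ≡ c * (a * b + d)
  lemma = solve-∀

-- The definition of `_⊗_` peels the left factor. Peeling the right one gives commutativity, and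
-- from it the mirrored laws.
⊗-unfoldʳ : ∀ f g n → (f ⊗ g) (suc n) ≡ f (suc n) * g 0 + (f ⊗ tail g) n
⊗-unfoldʳ f g zero    = ℤ.+-comm (f 0 * g 1) (f 1 * g 0)
⊗-unfoldʳ f g (suc n) = trans
  (cong (_+_ (f 0 * g (suc (suc n)))) (⊗-unfoldʳ (tail f) g n))
  (lemma (f 0 * g (suc (suc n))) (f (suc (suc n)) * g 0) _)
  where
  lemma : ∀ a b c → a + (b + c) ≡ b + (a + c)
  lemma = solve-∀

⊗-comm : ∀ f g → f ⊗ g ≗ g ⊗ f
⊗-comm f g zero    = ℤ.*-comm (f 0) (g 0)
⊗-comm f g (suc n) = trans
  (cong₂ _+_ (ℤ.*-comm (f 0) (g (suc n))) (⊗-comm (tail f) g n))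
  (sym (⊗-unfoldʳ g f n))

⊗-distribʳ : ∀ f g h → (g ⊕ h) ⊗ f ≗ g ⊗ f ⊕ h ⊗ f
⊗-distribʳ f g h n = trans (⊗-comm (g ⊕ h) f n)
  (trans (⊗-distribˡ f g h n) (cong₂ _+_ (⊗-comm f g n) (⊗-comm f h n)))

⊗-scaleʳ : ∀ c f g → f ⊗ scale c g ≗ scale c (f ⊗ g)
⊗-scaleʳ c f g n = trans (⊗-comm f (scale c g) n)
  (trans (⊗-scaleˡ c g f n) (cong (c *_) (⊗-comm g f n)))

⊗-assoc : ∀ f g h → (f ⊗ g) ⊗ h ≗ f ⊗ (g ⊗ h)
⊗-assoc f g h zero    = ℤ.*-assoc (f 0) (g 0) (h 0)
⊗-assoc f g h (suc n) = begin
  -- By definition `tail (f ⊗ g)` is `scale (f 0) (tail g) ⊕ tail f ⊗ g`.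
  f 0 * g 0 * h (suc n) + ((scale (f 0) (tail g) ⊕ tail f ⊗ g) ⊗ h) n
    ≡⟨ cong (_+_ (f 0 * g 0 * h (suc n))) (⊗-distribʳ h (scale (f 0) (tail g)) (tail f ⊗ g) n) ⟩
  f 0 * g 0 * h (suc n) + ((scale (f 0) (tail g) ⊗ h) n + ((tail f ⊗ g) ⊗ h) n)
    ≡⟨ cong₂ (λ a b → f 0 * g 0 * h (suc n) + (a + b))
         (⊗-scaleˡ (f 0) (tail g) h n) (⊗-assoc (tail f) g h n) ⟩
  f 0 * g 0 * h (suc n) + (f 0 * (tail g ⊗ h) n + (tail f ⊗ (g ⊗ h)) n)
    ≡⟨ lemma (f 0) (g 0) (h (suc n)) _ _ ⟩
  f 0 * (g ⊗ h) (suc n) + (tail f ⊗ (g ⊗ h)) n ∎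
  where
  lemma : ∀ a b c d e → a * b * c + (a * d + e) ≡ a * (b * c + d) + e
  lemma = solve-∀

⊗-y* : ∀ f g → f ⊗ (y* g) ≗ y* (f ⊗ g)
⊗-y* f g zero    = ℤ.*-zeroʳ (f 0)
⊗-y* f g (suc n) = trans (⊗-unfoldʳ f (y* g) n)
  (trans (cong (_+ (f ⊗ g) n) (ℤ.*-zeroʳ (f (suc n)))) (ℤ.+-identityˡ _))

⊗-constʳ : ∀ f c n → (f ⊗ const c) n ≡ f n * c
⊗-constʳ f c zero    = refl
⊗-constʳ f c (suc n) = trans (⊗-unfoldʳ f (const c) n)
  (trans (cong (_+_ (f (suc n) * c)) (zeros f n)) (ℤ.+-identityʳ _))
  where
  zeros : ∀ f n → (f ⊗ ⟦ [] ⟧) n ≡ 0ℤ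
  zeros f zero    = ℤ.*-zeroʳ (f 0)
  zeros f (suc n) = cong₂ _+_ (ℤ.*-zeroʳ (f 0)) (zeros (tail f) n)

⊗-∑ : ∀ m f (g : ℕ → Series) n →
      (f ⊗ (λ k → ∑ m λ c → g c k)) n ≡ ∑ m λ c → (f ⊗ g c) n
⊗-∑ m f g zero    = *-distribˡ-sum {m} (f 0) _
⊗-∑ m f g (suc n) = trans
  (cong₂ _+_ (*-distribˡ-sum {m} (f 0) _) (⊗-∑ m (tail f) g n))
  (sym (∑-distrib-+ {m} _ _))

-- Both series are the quotient of `p ⊗ g` by `p`, which is unique.
⊗-cancelˡ : ∀ p f g → p 0 ≡ 1ℤ → p ⊗ f ≗ p ⊗ g → f ≗ g
⊗-cancelˡ p f g p₀≡1 eq n = trans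
  (divide-unique f (p ⊗ g) p p₀≡1 (λ k → trans (⊗-comm f p k) (eq k)) n)
  (sym (divide-unique g (p ⊗ g) p p₀≡1 (⊗-comm g p) n))

θ : Series → Series
θ f n = + n * f n

θ≗y*d/dy : ∀ f → θ f ≗ y* d/dy f
θ≗y*d/dy f zero    = refl
θ≗y*d/dy f (suc n) = refl

θ-⊗ : ∀ f g → θ (f ⊗ g) ≗ θ f ⊗ g ⊕ f ⊗ θ g
θ-⊗ f g zero    = lemma (f 0) (g 0)
  where
  lemma : ∀ a b → 0ℤ * (a * b) ≡ 0ℤ * a * b + a * (0ℤ * b)
  lemma = solve-∀
θ-⊗ f g (suc n) = begin
  + suc n * (f 0 * g (suc n) + T)
    ≡⟨ lemma (+ n) (f 0) (g (suc n)) T ⟩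
  0ℤ * f 0 * g (suc n) + (T + + n * T) + f 0 * (+ suc n * g (suc n))
    ≡⟨ cong (λ z → 0ℤ * f 0 * g (suc n) + (T + z) + f 0 * (+ suc n * g (suc n))) (θ-⊗ (tail f) g n) ⟩
  0ℤ * f 0 * g (suc n) + (T + (U + V)) + f 0 * (+ suc n * g (suc n))
    ≡⟨ lemma′ (0ℤ * f 0 * g (suc n)) T U V _ ⟩
  0ℤ * f 0 * g (suc n) + (T + U) + (f 0 * (+ suc n * g (suc n)) + V)
    -- A tail has its degrees lowered by one, so `tail (θ f)` agrees with `tail f ⊕ θ (tail f)`.
    ≡⟨ cong (λ z → 0ℤ * f 0 * g (suc n) + z + (f 0 * (+ suc n * g (suc n)) + V))
         (trans (sym (⊗-distribʳ g (tail f) (θ (tail f)) n)) (⊗-cong (λ k → lemma″ (+ k) (f (suc k))) (λ _ → refl) n)) ⟩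
  0ℤ * f 0 * g (suc n) + (tail (θ f) ⊗ g) n + (f 0 * (+ suc n * g (suc n)) + V) ∎
  where
  T = (tail f ⊗ g) n
  U = (θ (tail f) ⊗ g) n
  V = (tail f ⊗ θ g) n
  lemma : ∀ n a b t → (1ℤ + n) * (a * b + t) ≡ 0ℤ * a * b + (t + n * t) + a * ((1ℤ + n) * b)
  lemma = solve-∀
  lemma′ : ∀ a t u v b → a + (t + (u + v)) + b ≡ a + (t + u) + (b + v)
  lemma′ = solve-∀
  lemma″ : ∀ n a → a + n * a ≡ (1ℤ + n) * a
  lemma″ = solve-∀

-- Generating functions of walks

act : (ℕ → ℕ → ℤ) → ℕ → (ℕ → Series) → ℕ → Series
act w m u a n = ∑ m λ c → w a c * u c n

⊗-act : ∀ w m p u a → p ⊗ act w m u a ≗ act w m (λ c → p ⊗ u c) a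
⊗-act w m p u a n = trans (⊗-∑ m p (λ c → scale (w a c) (u c)) n)
  (∑-cong m λ c _ → ⊗-scaleʳ (w a c) p (u c) n)

act-⊕ : ∀ w m u v a → act w m (λ c → u c ⊕ v c) a ≗ act w m u a ⊕ act w m v a
act-⊕ w m u v a n = trans
  (∑-cong m λ c _ → ℤ.*-distribˡ-+ (w a c) (u c n) (v c n))
  (∑-distrib-+ {m} _ _)

y*-cong : ∀ {f g} → f ≗ g → y* f ≗ y* g
y*-cong eq zero    = refl
y*-cong eq (suc n) = eq n

-- Because of the factor y, the coefficients of degree n + 1 are fixed by the source and by those of
-- degree n: 1 - y w is injective. Identities between entries of its inverse thus reduce to
-- exhibiting a common linear system.
act-unique : ∀ w m (s u v : ℕ → Series) →
  (∀ a → a < m → u a ≗ s a ⊕ y* act w m u a) →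
  (∀ a → a < m → v a ≗ s a ⊕ y* act w m v a) →
  ∀ a → a < m → u a ≗ v a
act-unique w m s u v equ eqv a a<m zero    = trans (equ a a<m 0) (sym (eqv a a<m 0))
act-unique w m s u v equ eqv a a<m (suc n) = begin
  u a (suc n)                      ≡⟨ equ a a<m (suc n) ⟩
  s a (suc n) + act w m u a n      ≡⟨ cong (_+_ (s a (suc n))) (∑-cong m λ c c<m →
                                        cong (_*_ (w a c)) (act-unique w m s u v equ eqv c c<m n)) ⟩
  s a (suc n) + act w m v a n      ≡⟨ eqv a a<m (suc n) ⟨
  v a (suc n)                      ∎

-- Σₙ (wⁿ)ₐᵦ yⁿ, that is the entries of (1 − y w)⁻¹, where w is cut down
-- to its leading m × m block.
walks : (ℕ → ℕ → ℤ) → ℕ → ℕ → ℕ → Series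
walks w m a b zero    = δ a b
walks w m a b (suc n) = ∑ m λ c → w a c * walks w m c b n

-- Column `b` of (1 - y w)⁻¹ solves the system with source e_b. The factor `p` is carried along
-- because the identities below are cleared of denominators.
⊗-walks : ∀ w m p a b →
  p ⊗ walks w m a b ≗ scale (δ a b) p ⊕ y* act w m (λ c → p ⊗ walks w m c b) a
⊗-walks w m p a b n = begin
  (p ⊗ walks w m a b) n
    ≡⟨ ⊗-cong (λ _ → refl) unfold n ⟩
  (p ⊗ (const (δ a b) ⊕ y* W)) n
    ≡⟨ ⊗-distribˡ p (const (δ a b)) (y* W) n ⟩
  (p ⊗ const (δ a b)) n + (p ⊗ (y* W)) n
    ≡⟨ cong₂ _+_ (trans (⊗-constʳ p (δ a b) n) (ℤ.*-comm (p n) (δ a b)))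
         (trans (⊗-y* p W n) (y*-cong (⊗-act w m p (λ c → walks w m c b) a) n)) ⟩
  δ a b * p n + (y* act w m (λ c → p ⊗ walks w m c b) a) n ∎
  where
  W = act w m (λ c → walks w m c b) a
  unfold : walks w m a b ≗ const (δ a b) ⊕ y* W
  unfold zero    = sym (ℤ.+-identityʳ (δ a b))
  unfold (suc n) = sym (ℤ.+-identityˡ (W n))

shift : (ℕ → ℕ → ℤ) → ℕ → ℕ → ℤ
shift w a b = w (suc a) (suc b)

-- A walk either avoids 0, or is cut at its first and at its last visit to 0.
walks-through-0 : ∀ w m a b → a < m →
  walks w (suc m) 0 0 ⊗ walks w (suc m) (suc a) (suc b) ≗
  walks w (suc m) 0 0 ⊗ walks (shift w) m a b
    ⊕ walks w (suc m) 0 (suc b) ⊗ walks w (suc m) (suc a) 0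
walks-through-0 w m a b = act-unique (shift w) m s u v equ eqv a
  where
  p = walks w (suc m) 0 0
  r = walks w (suc m) 0 (suc b)
  s u v v₁ v₂ : ℕ → Series
  s a = scale (δ a b) p ⊕ y* scale (w (suc a) 0) (p ⊗ r)
  u a = p ⊗ walks w (suc m) (suc a) (suc b)
  v₁ a = p ⊗ walks (shift w) m a b
  v₂ a = r ⊗ walks w (suc m) (suc a) 0
  v a = v₁ a ⊕ v₂ a

  equ : ∀ a → a < m → u a ≗ s a ⊕ y* act (shift w) m u a
  equ a _ zero    = trans (⊗-walks w (suc m) p (suc a) (suc b) 0) (sym (ℤ.+-identityʳ _))
  equ a _ (suc n) = trans (⊗-walks w (suc m) p (suc a) (suc b) (suc n)) (sym (ℤ.+-assoc (scale (δ a b) p (suc n)) _ _))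

  eqv : ∀ a → a < m → v a ≗ s a ⊕ y* act (shift w) m v a
  eqv a _ zero    = trans
    (cong₂ _+_ (⊗-walks (shift w) m p a b 0) (⊗-walks w (suc m) r (suc a) 0 0))
    (lemma (scale (δ a b) p 0) (r 0))
    where
    lemma : ∀ x y → x + 0ℤ + (0ℤ * y + 0ℤ) ≡ x + 0ℤ + 0ℤ
    lemma = solve-∀
  eqv a _ (suc n) = begin
    v₁ a (suc n) + v₂ a (suc n)
      ≡⟨ cong₂ _+_ (⊗-walks (shift w) m p a b (suc n)) (⊗-walks w (suc m) r (suc a) 0 (suc n)) ⟩
    x + act (shift w) m v₁ a n + (0ℤ * r (suc n) + (w (suc a) 0 * (r ⊗ p) n + act (shift w) m v₂ a n))
      ≡⟨ cong (λ z → x + act (shift w) m v₁ a n + (0ℤ * r (suc n) + (w (suc a) 0 * z + act (shift w) m v₂ a n)))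
           (⊗-comm r p n) ⟩
    x + act (shift w) m v₁ a n + (0ℤ * r (suc n) + (w (suc a) 0 * (p ⊗ r) n + act (shift w) m v₂ a n))
      ≡⟨ lemma x _ (r (suc n)) _ _ ⟩
    x + w (suc a) 0 * (p ⊗ r) n + (act (shift w) m v₁ a n + act (shift w) m v₂ a n)
      ≡⟨ cong (_+_ (x + w (suc a) 0 * (p ⊗ r) n)) (act-⊕ (shift w) m v₁ v₂ a n) ⟨
    x + w (suc a) 0 * (p ⊗ r) n + act (shift w) m v a n ∎
    where
    x = scale (δ a b) p (suc n)
    lemma : ∀ x y z t s → x + y + (0ℤ * z + (t + s)) ≡ x + t + (y + s)
    lemma = solve-∀

-- A walk of length n is cut in two at any of its n + 1 vertices.
walks-cut : ∀ w m a b → a < m → ∀ n →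
  ∑ m (λ c → (walks w m a c ⊗ walks w m c b) n) ≡ + suc n * walks w m a b n
walks-cut w m a b a<m zero    = trans (∑-δ m a (λ c → δ c b) a<m) (sym (ℤ.*-identityˡ _))
walks-cut w m a b a<m (suc n) = begin
  -- The `δ` term is the cut at the starting vertex; the other term cuts after a first step from `a`
  -- to some `d`.
  ∑ m (λ c → δ a c * X c b (suc n) + (act w m (λ d → X d c) a ⊗ X c b) n)
    ≡⟨ ∑-distrib-+ {m} _ _ ⟩
  ∑ m (λ c → δ a c * X c b (suc n)) + ∑ m (λ c → (act w m (λ d → X d c) a ⊗ X c b) n)
    ≡⟨ cong₂ _+_ (∑-δ m a (λ c → X c b (suc n)) a<m) (∑-cong m λ c _ → act-⊗ c) ⟩
  X a b (suc n) + ∑ m (λ c → ∑ m λ d → w a d * (X d c ⊗ X c b) n)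
    ≡⟨ cong (_+_ (X a b (suc n))) (∑-comm {m} {m} _) ⟩
  X a b (suc n) + ∑ m (λ d → ∑ m λ c → w a d * (X d c ⊗ X c b) n)
    ≡⟨ cong (_+_ (X a b (suc n))) (∑-cong m λ d d<m → begin
         ∑ m (λ c → w a d * (X d c ⊗ X c b) n)  ≡⟨ *-distribˡ-sum {m} (w a d) _ ⟨
         w a d * ∑ m (λ c → (X d c ⊗ X c b) n)  ≡⟨ cong (_*_ (w a d)) (walks-cut w m d b d<m n) ⟩
         w a d * (+ suc n * X d b n)            ≡⟨ lemma (w a d) (+ suc n) (X d b n) ⟩
         + suc n * (w a d * X d b n)            ∎) ⟩
  X a b (suc n) + ∑ m (λ d → + suc n * (w a d * X d b n))
    ≡⟨ cong (_+_ (X a b (suc n))) (*-distribˡ-sum {m} (+ suc n) _) ⟨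
  X a b (suc n) + + suc n * X a b (suc n)
    ≡⟨ lemma′ (+ suc n) (X a b (suc n)) ⟩
  + suc (suc n) * X a b (suc n) ∎
  where
  X = walks w m
  act-⊗ : ∀ c → (act w m (λ d → X d c) a ⊗ X c b) n ≡ ∑ m (λ d → w a d * (X d c ⊗ X c b) n)
  act-⊗ c = trans (⊗-comm _ (X c b) n) (trans (⊗-act w m (X c b) (λ d → X d c) a n)
    (∑-cong m λ d _ → cong (_*_ (w a d)) (⊗-comm (X c b) (X d c) n)))
  lemma : ∀ x y z → x * (y * z) ≡ y * (x * z)
  lemma = solve-∀
  lemma′ : ∀ n x → x + n * x ≡ (1ℤ + n) * x
  lemma′ = solve-∀

-- Traces and the removal of an index

trace : (ℕ → ℕ → ℤ) → ℕ → Series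
trace w m n = ∑ m λ a → walks w m a a n

-- On the diagonal, `walks-through-0` leaves the products of a walk from 0 to a and a walk from a to
-- 0. Together with `p ⊗ p` they are all cuts of closed walks at 0, and `walks-cut` counts each such
-- walk of length n exactly n + 1 times.
trace-through-0 : ∀ w m → let p = walks w (suc m) 0 0 in
  p ⊗ trace w (suc m) ≗ p ⊗ trace (shift w) m ⊕ (p ⊕ θ p)
trace-through-0 w m n = begin
  (p ⊗ trace w (suc m)) n
    ≡⟨ ⊗-∑ (suc m) p (λ a → X a a) n ⟩
  (p ⊗ p) n + ∑ m (λ a → (p ⊗ X (suc a) (suc a)) n)
    ≡⟨ cong (_+_ ((p ⊗ p) n)) (∑-cong m λ a a<m → walks-through-0 w m a a a<m n) ⟩
  (p ⊗ p) n + ∑ m (λ a → (p ⊗ Y a a) n + (X 0 (suc a) ⊗ X (suc a) 0) n)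
    ≡⟨ cong (_+_ ((p ⊗ p) n)) (∑-distrib-+ {m} _ _) ⟩
  (p ⊗ p) n + (∑ m (λ a → (p ⊗ Y a a) n) + ∑ m (λ a → (X 0 (suc a) ⊗ X (suc a) 0) n))
    ≡⟨ lemma ((p ⊗ p) n) (∑ m λ a → (p ⊗ Y a a) n) (∑ m λ a → (X 0 (suc a) ⊗ X (suc a) 0) n) ⟩
  ∑ m (λ a → (p ⊗ Y a a) n) + ∑ (suc m) (λ a → (X 0 a ⊗ X a 0) n)
    ≡⟨ cong₂ _+_ (sym (⊗-∑ m p (λ a → Y a a) n)) (walks-cut w (suc m) 0 0 ℕ.z<s n) ⟩
  (p ⊗ trace (shift w) m) n + (1ℤ + + n) * p n
    ≡⟨ cong (_+_ ((p ⊗ trace (shift w) m) n)) (lemma′ (+ n) (p n)) ⟩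
  (p ⊗ trace (shift w) m) n + (p n + + n * p n) ∎
  where
  X = walks w (suc m)
  Y = walks (shift w) m
  p = X 0 0
  lemma : ∀ x y z → x + (y + z) ≡ y + (x + z)
  lemma = solve-∀
  lemma′ : ∀ n x → (1ℤ + n) * x ≡ x + n * x
  lemma′ = solve-∀

module _ (w : ℕ → ℕ → ℤ) (m : ℕ) (col≡0 : ∀ a → w a m ≡ 0ℤ) (row≡0 : ∀ b → w m b ≡ 0ℤ) where

  -- Column `m` vanishes, so no step enters `m`.
  walks-isolated : ∀ a b → walks w (suc m) a b ≗ walks w m a b
  walks-isolated a b zero    = refl
  walks-isolated a b (suc n) = begin
    ∑ (suc m) (λ c → w a c * walks w (suc m) c b n)
      ≡⟨ ∑-last m (λ c → w a c * walks w (suc m) c b n) ⟩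
    ∑ m (λ c → w a c * walks w (suc m) c b n) + w a m * walks w (suc m) m b n
      ≡⟨ cong₂ _+_ (∑-cong m λ c _ → cong (_*_ (w a c)) (walks-isolated c b n))
           (trans (cong (_* walks w (suc m) m b n) (col≡0 a)) (ℤ.*-zeroˡ (walks w (suc m) m b n))) ⟩
    walks w m a b (suc n) + 0ℤ
      ≡⟨ ℤ.+-identityʳ _ ⟩
    walks w m a b (suc n) ∎

  -- The isolated index carries only the empty closed walk, whence the constant 1.
  trace-isolated : trace w (suc m) ≗ trace w m ⊕ const 1ℤ
  trace-isolated n = trans (∑-last m λ a → walks w (suc m) a a n)
    (cong₂ _+_ (∑-cong m λ a _ → walks-isolated a a n) (loop n))
    where
    loop : walks w (suc m) m m ≗ const 1ℤ
    loop zero    = δ-refl m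
    loop (suc n) = ∑-zero (suc m) λ c →
      trans (cong (_* walks w (suc m) c m n) (row≡0 c)) (ℤ.*-zeroˡ (walks w (suc m) c m n))

-- The polynomials Q and their cofactors

sgn : ℕ → ℤ
sgn zero    = 1ℤ
sgn (suc n) = - sgn n

sgn² : ∀ n → sgn n * sgn n ≡ 1ℤ
sgn² zero    = refl
sgn² (suc n) = trans (lemma (sgn n)) (sgn² n)
  where
  lemma : ∀ a → - a * - a ≡ a * a
  lemma = solve-∀

-- The substitution of - y for y, matching `_⟨-y⟩` on polynomials.
bar : Series → Series
bar f n = sgn n * f n

y*-bar : ∀ f n → (y* bar f) n ≡ - (sgn n * (y* f) n)
y*-bar f zero    = refl
y*-bar f (suc n) = lemma (sgn n) (f n)
  where
  lemma : ∀ a b → a * b ≡ - (- a * b)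
  lemma = solve-∀

sgn-y*-bar : ∀ f n → sgn n * (y* bar f) n ≡ - (y* f) n
sgn-y*-bar f n = begin
  sgn n * (y* bar f) n            ≡⟨ cong (_*_ (sgn n)) (y*-bar f n) ⟩
  sgn n * - (sgn n * (y* f) n)    ≡⟨ lemma (sgn n) _ ⟩
  - (sgn n * sgn n * (y* f) n)    ≡⟨ cong (λ z → - (z * (y* f) n)) (sgn² n) ⟩
  - (1ℤ * (y* f) n)               ≡⟨ cong -_ (ℤ.*-identityˡ _) ⟩
  - (y* f) n                      ∎
  where
  lemma : ∀ a b → a * - (a * b) ≡ - (a * a * b)
  lemma = solve-∀

⟦⟧-+ᴾ : ∀ p q → ⟦ p +ᴾ q ⟧ ≗ ⟦ p ⟧ ⊕ ⟦ q ⟧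
⟦⟧-+ᴾ []      q       n       = sym (ℤ.+-identityˡ _)
⟦⟧-+ᴾ (a ∷ p) []      n       = sym (ℤ.+-identityʳ _)
⟦⟧-+ᴾ (a ∷ p) (b ∷ q) zero    = refl
⟦⟧-+ᴾ (a ∷ p) (b ∷ q) (suc n) = ⟦⟧-+ᴾ p q n

⟦⟧-∙ᴾ : ∀ c p → ⟦ c ∙ᴾ p ⟧ ≗ scale c ⟦ p ⟧
⟦⟧-∙ᴾ c []      n       = sym (ℤ.*-zeroʳ c)
⟦⟧-∙ᴾ c (a ∷ p) zero    = refl
⟦⟧-∙ᴾ c (a ∷ p) (suc n) = ⟦⟧-∙ᴾ c p n

⟦⟧-⟨-y⟩ : ∀ p → ⟦ p ⟨-y⟩ ⟧ ≗ bar ⟦ p ⟧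
⟦⟧-⟨-y⟩ []      n       = sym (ℤ.*-zeroʳ (sgn n))
⟦⟧-⟨-y⟩ (a ∷ p) zero    = sym (ℤ.*-identityˡ a)
⟦⟧-⟨-y⟩ (a ∷ p) (suc n) = begin
  ⟦ -ᴾ (p ⟨-y⟩) ⟧ n                   ≡⟨ ⟦⟧-∙ᴾ -1ℤ (p ⟨-y⟩) n ⟩
  -1ℤ * ⟦ p ⟨-y⟩ ⟧ n                ≡⟨ cong (_*_ -1ℤ) (⟦⟧-⟨-y⟩ p n) ⟩
  -1ℤ * (sgn n * ⟦ p ⟧ n)           ≡⟨ lemma (sgn n) _ ⟩
  - sgn n * ⟦ p ⟧ n                   ∎
  where
  lemma : ∀ a b → -1ℤ * (a * b) ≡ - a * b
  lemma = solve-∀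

-- R n is Q (n − 3), where Q₋₁ = Q₋₂ = Q₋₃ = 1 extend the recurrence backwards.
R : ℕ → Poly
R 0 = 1ℤ ∷ []
R 1 = 1ℤ ∷ []
R 2 = 1ℤ ∷ []
R (suc (suc (suc s))) = Q s

-- The first three cases recompute the explicit `Q 1`, `Q 2` and `Q 3`; afterwards this is the
-- defining recurrence.
R-rec : ∀ n → R (4 ℕ.+ n) ≡
  (-ᴾ (y*ᴾ (R (3 ℕ.+ n) ⟨-y⟩ +ᴾ R (1 ℕ.+ n) ⟨-y⟩))) +ᴾ (+ 2 ∙ᴾ R (2 ℕ.+ n)) -ᴾ R n
R-rec 0 = refl
R-rec 1 = refl
R-rec 2 = refl
R-rec (suc (suc (suc n))) = refl

r : ℕ → Series
r n = ⟦ R n ⟧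

r-rec : ∀ m n → r (4 ℕ.+ m) n + r m n + ((y* bar (r (3 ℕ.+ m))) n + (y* bar (r (1 ℕ.+ m))) n)
              ≡ r (2 ℕ.+ m) n + r (2 ℕ.+ m) n
r-rec m n = trans
  (cong (λ z → z + r m n + ((y* bar (r (3 ℕ.+ m))) n + (y* bar (r (1 ℕ.+ m))) n)) expand)
  (lemma ((y* bar (r (3 ℕ.+ m))) n) ((y* bar (r (1 ℕ.+ m))) n) (r (2 ℕ.+ m) n) (r m n))
  where
  A = R (3 ℕ.+ m) ⟨-y⟩
  B = R (1 ℕ.+ m) ⟨-y⟩
  C = R (2 ℕ.+ m)
  y*ᴾ-+ : ∀ n → ⟦ y*ᴾ (A +ᴾ B) ⟧ n ≡ (y* bar (r (3 ℕ.+ m))) n + (y* bar (r (1 ℕ.+ m))) n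
  y*ᴾ-+ zero    = refl
  y*ᴾ-+ (suc n) = trans (⟦⟧-+ᴾ A B n)
    (cong₂ _+_ (⟦⟧-⟨-y⟩ (R (3 ℕ.+ m)) n) (⟦⟧-⟨-y⟩ (R (1 ℕ.+ m)) n))
  expand : r (4 ℕ.+ m) n ≡
    -1ℤ * ((y* bar (r (3 ℕ.+ m))) n + (y* bar (r (1 ℕ.+ m))) n) + + 2 * ⟦ C ⟧ n + -1ℤ * r m n
  expand = begin
    ⟦ R (4 ℕ.+ m) ⟧ n
      ≡⟨ cong (λ p → ⟦ p ⟧ n) (R-rec m) ⟩
    ⟦ (-ᴾ (y*ᴾ (A +ᴾ B))) +ᴾ (+ 2 ∙ᴾ C) -ᴾ R m ⟧ n
      ≡⟨ ⟦⟧-+ᴾ ((-ᴾ (y*ᴾ (A +ᴾ B))) +ᴾ (+ 2 ∙ᴾ C)) (-ᴾ R m) n ⟩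
    ⟦ (-ᴾ (y*ᴾ (A +ᴾ B))) +ᴾ (+ 2 ∙ᴾ C) ⟧ n + ⟦ -ᴾ R m ⟧ n
      ≡⟨ cong₂ _+_ (⟦⟧-+ᴾ (-ᴾ (y*ᴾ (A +ᴾ B))) (+ 2 ∙ᴾ C) n) (⟦⟧-∙ᴾ -1ℤ (R m) n) ⟩
    ⟦ -ᴾ (y*ᴾ (A +ᴾ B)) ⟧ n + ⟦ + 2 ∙ᴾ C ⟧ n + -1ℤ * r m n
      ≡⟨ cong (_+ -1ℤ * r m n) (cong₂ _+_
           (trans (⟦⟧-∙ᴾ -1ℤ (y*ᴾ (A +ᴾ B)) n) (cong (_*_ -1ℤ) (y*ᴾ-+ n)))
           (⟦⟧-∙ᴾ (+ 2) C n)) ⟩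
    -1ℤ * ((y* bar (r (3 ℕ.+ m))) n + (y* bar (r (1 ℕ.+ m))) n) + + 2 * ⟦ C ⟧ n + -1ℤ * r m n ∎
  lemma : ∀ a b c d → -1ℤ * (a + b) + + 2 * c + -1ℤ * d + d + (a + b) ≡ c + c
  lemma = solve-∀

-- For m = i + k and k > 0, G i k is the cofactor (k , 0) of 1 − y T, T being
-- the matrix of size m with entries (m − a − b)⁺; at k = 0 it is that cofactor
-- minus the determinant.  The recursion comes from differencing: if
-- Δ² g(j) = y g(m − j), then h = Δ g satisfies Δ² h(j) = − y h(m − 1 − j).
G : ℕ → ℕ → Series
G zero    k       n = 0ℤ
G (suc i) zero    n = r (suc i) n - r (3 ℕ.+ i) n
G (suc i) (suc k) n = G i k n - sgn n * G (suc k) i n + sgn n * G k (suc i) n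

G-right : ∀ i n → G i 0 n ≡ r i n - r (2 ℕ.+ i) n
G-right zero    n = sym (ℤ.+-inverseʳ (r 0 n))
G-right (suc i) n = refl

-- For size k + 1, row k of the matrix has 1 in column 0 as its only nonzero entry, so y times the
-- cofactor (0 , 0) is the value to expect. That system is not yet available, and the proof is a
-- mutual recursion with `G-right₁`, whose first two terms are `G (suc i) 0` and whose last term is
-- a first difference.
G-left : ∀ k → G 1 k ≗ y* r (suc k)
G-right₁ : ∀ i n → G i 1 n ≡ r (1 ℕ.+ i) n - r (3 ℕ.+ i) n - (y* bar (r (2 ℕ.+ i))) n

G-left zero    zero          = refl
G-left zero    (suc zero)    = refl
G-left zero    (suc (suc n)) = refl
G-left (suc k) n             = begin
  0ℤ - sgn n * G (suc k) 0 n + sgn n * G k 1 n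
    ≡⟨ cong (λ z → 0ℤ - sgn n * G (suc k) 0 n + sgn n * z) (G-right₁ k n) ⟩
  0ℤ - sgn n * (a - b) + sgn n * (a - b - (y* bar (r (2 ℕ.+ k))) n)
    ≡⟨ lemma (sgn n) a b _ ⟩
  - (sgn n * (y* bar (r (2 ℕ.+ k))) n)
    ≡⟨ cong -_ (sgn-y*-bar (r (2 ℕ.+ k)) n) ⟩
  - - (y* r (2 ℕ.+ k)) n
    ≡⟨ ℤ.neg-involutive _ ⟩
  (y* r (2 ℕ.+ k)) n ∎
  where
  a = r (1 ℕ.+ k) n
  b = r (3 ℕ.+ k) n
  lemma : ∀ s a b c → 0ℤ - s * (a - b) + s * (a - b - c) ≡ - (s * c)
  lemma = solve-∀

G-right₁ zero    zero                = refl
G-right₁ zero    (suc zero)          = refl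
G-right₁ zero    (suc (suc n))       = sym (cong (λ z → 0ℤ - 0ℤ - z) (ℤ.*-zeroʳ (sgn (suc n))))
G-right₁ (suc i) n                   = begin
  G i 0 n - sgn n * G 1 i n + sgn n * 0ℤ
    ≡⟨ cong₂ (λ u v → u - sgn n * v + sgn n * 0ℤ) (G-right i n) (G-left i n) ⟩
  r i n - r (2 ℕ.+ i) n - sgn n * (y* r (1 ℕ.+ i)) n + sgn n * 0ℤ
    ≡⟨ lemma (r i n) (r (2 ℕ.+ i) n) (sgn n) _ (r (4 ℕ.+ i) n) ((y* bar (r (3 ℕ.+ i))) n) ⟩
  (r (4 ℕ.+ i) n + r i n + ((y* bar (r (3 ℕ.+ i))) n + - (sgn n * (y* r (1 ℕ.+ i)) n)))
    - r (2 ℕ.+ i) n - r (4 ℕ.+ i) n - (y* bar (r (3 ℕ.+ i))) n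
    ≡⟨ cong (λ z → z - r (2 ℕ.+ i) n - r (4 ℕ.+ i) n - (y* bar (r (3 ℕ.+ i))) n)
         (trans (cong (λ z → r (4 ℕ.+ i) n + r i n + ((y* bar (r (3 ℕ.+ i))) n + z))
                  (sym (y*-bar (r (1 ℕ.+ i)) n)))
                (r-rec i n)) ⟩
  r (2 ℕ.+ i) n + r (2 ℕ.+ i) n - r (2 ℕ.+ i) n - r (4 ℕ.+ i) n - (y* bar (r (3 ℕ.+ i))) n
    ≡⟨ lemma′ (r (2 ℕ.+ i) n) (r (4 ℕ.+ i) n) _ ⟩
  r (2 ℕ.+ i) n - r (4 ℕ.+ i) n - (y* bar (r (3 ℕ.+ i))) n ∎
  where
  lemma : ∀ a b s c d e → a - b - s * c + s * 0ℤ ≡ (d + a + (e + - (s * c))) - b - d - e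
  lemma = solve-∀
  lemma′ : ∀ a b c → a + a - a - b - c ≡ a - b - c
  lemma′ = solve-∀

y*-⊖⊖ : ∀ f g h n → (y* (λ n → f n - g n - h n)) n ≡ (y* f) n - (y* g) n - (y* h) n
y*-⊖⊖ f g h zero    = refl
y*-⊖⊖ f g h (suc n) = refl

y*y*-bar : ∀ f n → (y* y* bar f) n ≡ sgn n * (y* y* f) n
y*y*-bar f zero    = refl
y*y*-bar f (suc n) = trans (y*-bar f n) (ℤ.neg-distribˡ-* (sgn n) _)

sgn-y*y*-bar : ∀ f n → sgn n * (y* y* bar f) n ≡ (y* y* f) n
sgn-y*y*-bar f n = begin
  sgn n * (y* y* bar f) n            ≡⟨ cong (_*_ (sgn n)) (y*y*-bar f n) ⟩
  sgn n * (sgn n * (y* y* f) n)      ≡⟨ ℤ.*-assoc (sgn n) (sgn n) _ ⟨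
  sgn n * sgn n * (y* y* f) n        ≡⟨ cong (_* (y* y* f) n) (sgn² n) ⟩
  1ℤ * (y* y* f) n                   ≡⟨ ℤ.*-identityˡ _ ⟩
  (y* y* f) n                        ∎

y*-r-rec : ∀ m n →
  (y* r (4 ℕ.+ m)) n + (y* r m) n + ((y* y* bar (r (3 ℕ.+ m))) n + (y* y* bar (r (1 ℕ.+ m))) n)
    ≡ (y* r (2 ℕ.+ m)) n + (y* r (2 ℕ.+ m)) n
y*-r-rec m zero    = refl
y*-r-rec m (suc n) = r-rec m n

y*-G-right₁ : ∀ i n → (y* G i 1) n ≡
  (y* r (1 ℕ.+ i)) n - (y* r (3 ℕ.+ i)) n - (y* y* bar (r (2 ℕ.+ i))) n
y*-G-right₁ i n = trans (y*-cong (G-right₁ i) n)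
  (y*-⊖⊖ (r (1 ℕ.+ i)) (r (3 ℕ.+ i)) (y* bar (r (2 ℕ.+ i))) n)

-- The recursion of `G` times y: the shift of the degree negates `sgn`, which exchanges the two
-- signs.
y*-G-step : ∀ i k n → (y* G (suc i) (suc k)) n ≡
  (y* G i k) n + sgn n * (y* G (suc k) i) n - sgn n * (y* G k (suc i)) n
y*-G-step i k zero    = refl
y*-G-step i k (suc n) = lemma (G i k n) (sgn n) _ _
  where
  lemma : ∀ a s b c → a - s * b + s * c ≡ a + - s * b - - s * c
  lemma = solve-∀

-- This is (1 − y T) g = det · e₀ after two differences, which turn the kernel
-- (m − a − b)⁺ into the indicator of a + b = m − 1.
G-second-difference : ∀ j k n → G j (2 ℕ.+ k) n + G (2 ℕ.+ j) k n ≡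
  G (1 ℕ.+ j) (1 ℕ.+ k) n + G (1 ℕ.+ j) (1 ℕ.+ k) n + (y* G (1 ℕ.+ k) (1 ℕ.+ j)) n
G-second-difference zero zero 0 = refl
G-second-difference zero zero 1 = refl
G-second-difference zero zero 2 = refl
G-second-difference zero zero (suc (suc (suc n))) =
  sym (cong₂ (λ a b → a + a + b) (G-left 1 (3 ℕ.+ n)) (G-left 1 (2 ℕ.+ n)))
-- Adding and subtracting `G (2 ℕ.+ k) 0`, which is a - b, completes the instance at (k , 0). Then
-- `G-left` and `G-right₁` turn everything into `r`, and y times its recurrence closes the case.
G-second-difference zero (suc k) n = begin
  0ℤ + (G 1 k n - s * B + s * G k 2 n)
    ≡⟨ lemma s (G 1 k n) B (G k 2 n) (a - b) ⟩
  G 1 k n - s * B + s * ((G k 2 n + (a - b)) - (a - b))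
    ≡⟨ cong (λ z → G 1 k n - s * B + s * (z - (a - b))) (G-second-difference k 0 n) ⟩
  G 1 k n - s * B + s * ((B + B + (y* G 1 (suc k)) n) - (a - b))
    ≡⟨ lemma₁ s (G 1 k n) B _ _ ⟩
  G 1 k n + s * (B - (a - b) + (y* G 1 (suc k)) n)
    ≡⟨ cong₂ (λ u v → u + s * v) (G-left k n) (cong₂ (λ u v → u - (a - b) + v)
         (G-right₁ (suc k) n) (y*-cong (G-left (suc k)) n)) ⟩
  c + s * (a - b - x - (a - b) + (y* y* r (2 ℕ.+ k)) n)
    ≡⟨ lemma₂ s c (a - b) x _ ⟩
  c - s * x + s * (y* y* r (2 ℕ.+ k)) n
    ≡⟨ cong₂ (λ u v → c - u + v) (sgn-y*-bar (r (3 ℕ.+ k)) n) (sym (y*y*-bar (r (2 ℕ.+ k)) n)) ⟩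
  c - - X + D
    ≡⟨ lemma₃ c X D ((y* r (5 ℕ.+ k)) n) ((y* y* bar (r (4 ℕ.+ k))) n) ⟩
  X - (y* r (5 ℕ.+ k)) n - (y* y* bar (r (4 ℕ.+ k))) n
    + ((y* r (5 ℕ.+ k)) n + c + ((y* y* bar (r (4 ℕ.+ k))) n + D))
    ≡⟨ cong₂ _+_ (sym (y*-G-right₁ (2 ℕ.+ k) n)) (y*-r-rec (suc k) n) ⟩
  (y* G (2 ℕ.+ k) 1) n + (X + X)
    ≡⟨ ℤ.+-comm _ (X + X) ⟩
  X + X + (y* G (2 ℕ.+ k) 1) n
    ≡⟨ cong (λ z → z + z + (y* G (2 ℕ.+ k) 1) n) (G-left (2 ℕ.+ k) n) ⟨
  G 1 (2 ℕ.+ k) n + G 1 (2 ℕ.+ k) n + (y* G (2 ℕ.+ k) 1) n ∎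
  where
  s = sgn n
  a = r (2 ℕ.+ k) n
  b = r (4 ℕ.+ k) n
  c = (y* r (suc k)) n
  x = (y* bar (r (3 ℕ.+ k))) n
  B = G (suc k) 1 n
  X = (y* r (3 ℕ.+ k)) n
  D = (y* y* bar (r (2 ℕ.+ k))) n
  lemma : ∀ s a b c d → 0ℤ + (a - s * b + s * c) ≡ a - s * b + s * (c + d - d)
  lemma = solve-∀
  lemma₁ : ∀ s a b c d → a - s * b + s * (b + b + c - d) ≡ a + s * (b - d + c)
  lemma₁ = solve-∀
  lemma₂ : ∀ s c d x e → c + s * (d - x - d + e) ≡ c - s * x + s * e
  lemma₂ = solve-∀
  lemma₃ : ∀ c x d u v → c - - x + d ≡ x - u - v + (u + c + (v + d))
  lemma₃ = solve-∀
-- The inserted 0 is `G 0 (2 ℕ.+ j)`, which makes `G 2 j` part of the instance at (0 , j).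
G-second-difference (suc j) zero n = begin
  G j 1 n - s * G 2 j n + s * u + (r₃ - r₅)
    ≡⟨ lemma (G j 1 n) s (G 2 j n) u (r₃ - r₅) ⟩
  G j 1 n - s * (0ℤ + G 2 j n) + s * u + (r₃ - r₅)
    ≡⟨ cong₂ (λ x z → x - s * z + s * u + (r₃ - r₅)) (G-right₁ j n) (G-second-difference 0 j n) ⟩
  r₁ - r₃ - y₂ - s * (u + u + (y* G (1 ℕ.+ j) 1) n) + s * u + (r₃ - r₅)
    ≡⟨ cong₂ (λ x z → r₁ - r₃ - y₂ - s * (x + x + z) + s * x + (r₃ - r₅))
         (G-left (1 ℕ.+ j) n) (y*-G-right₁ (1 ℕ.+ j) n) ⟩
  r₁ - r₃ - y₂ - s * (v + v + (v - w - z)) + s * v + (r₃ - r₅)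
    ≡⟨ lemma₁ r₁ r₃ y₂ s v w z r₅ ⟩
  r₁ - r₅ - y₂ + (- (s * v) + - (s * v)) - (- (s * w)) + s * z
    ≡⟨ cong₂ (λ p q → r₁ - r₅ - y₂ + (p + p) - q + s * z)
         (sym (y*-bar (r (2 ℕ.+ j)) n)) (sym (y*-bar (r (4 ℕ.+ j)) n)) ⟩
  r₁ - r₅ - y₂ + (y₂ + y₂) - y₄ + s * z
    ≡⟨ lemma₂ r₁ r₅ y₂ y₄ (s * z) ⟩
  (r₅ + r₁ + (y₄ + y₂)) - (r₅ + r₅) - (y₄ + y₄) + s * z
    ≡⟨ cong₂ (λ p q → p - (r₅ + r₅) - (y₄ + y₄) + q) (r-rec (suc j) n) (sgn-y*y*-bar (r (3 ℕ.+ j)) n) ⟩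
  r₃ + r₃ - (r₅ + r₅) - (y₄ + y₄) + (y* y* r (3 ℕ.+ j)) n
    ≡⟨ lemma₃ r₃ r₅ y₄ _ ⟩
  (r₃ - r₅ - y₄) + (r₃ - r₅ - y₄) + (y* y* r (3 ℕ.+ j)) n
    ≡⟨ cong₂ (λ p q → p + p + q) (G-right₁ (2 ℕ.+ j) n) (y*-cong (G-left (2 ℕ.+ j)) n) ⟨
  G (2 ℕ.+ j) 1 n + G (2 ℕ.+ j) 1 n + (y* G 1 (2 ℕ.+ j)) n ∎
  where
  s = sgn n
  r₁ = r (1 ℕ.+ j) n
  r₃ = r (3 ℕ.+ j) n
  r₅ = r (5 ℕ.+ j) n
  y₂ = (y* bar (r (2 ℕ.+ j))) n
  y₄ = (y* bar (r (4 ℕ.+ j))) n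
  u = G 1 (1 ℕ.+ j) n
  v = (y* r (2 ℕ.+ j)) n
  w = (y* r (4 ℕ.+ j)) n
  z = (y* y* bar (r (3 ℕ.+ j))) n
  lemma : ∀ a s b u d → a - s * b + s * u + d ≡ a - s * (0ℤ + b) + s * u + d
  lemma = solve-∀
  lemma₁ : ∀ a b y s v w z c → a - b - y - s * (v + v + (v - w - z)) + s * v + (b - c)
    ≡ a - c - y + (- (s * v) + - (s * v)) - (- (s * w)) + s * z
  lemma₁ = solve-∀
  lemma₂ : ∀ a c y x z → a - c - y + (y + y) - x + z ≡ (c + a + (x + y)) - (c + c) - (x + x) + z
  lemma₂ = solve-∀
  lemma₃ : ∀ a c x z → a + a - (c + c) - (x + x) + z ≡ (a - c - x) + (a - c - x) + z
  lemma₃ = solve-∀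
-- Unfolding the outer terms gives three instances, at (j , k), (k + 1 , j) and (k , j + 1), each of
-- smaller index sum.
G-second-difference (suc j) (suc k) n = begin
  (a₁ - s * c₂ + s * b₂) + (c₁ - s * a₂ + s * a₃)
    ≡⟨ lemma s a₁ c₁ a₂ c₂ a₃ b₂ ⟩
  (a₁ + c₁) - s * (a₂ + c₂) + s * (a₃ + b₂)
    ≡⟨ cong₂ _+_ (cong₂ (λ u v → u - s * v)
         (G-second-difference j k n) (G-second-difference (suc k) j n))
         (cong (_*_ s) (G-second-difference k (suc j) n)) ⟩
  (b₁ + b₁ + d₁) - s * (b₂ + b₂ + d₂) + s * (a₂ + a₂ + d₃)
    ≡⟨ lemma′ s b₁ d₁ b₂ d₂ a₂ d₃ ⟩
  (b₁ - s * b₂ + s * a₂) + (b₁ - s * b₂ + s * a₂) + (d₁ + s * d₃ - s * d₂)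
    ≡⟨ cong (_+_ ((b₁ - s * b₂ + s * a₂) + (b₁ - s * b₂ + s * a₂))) (y*-G-step (suc k) (suc j) n) ⟨
  (b₁ - s * b₂ + s * a₂) + (b₁ - s * b₂ + s * a₂) + (y* G (2 ℕ.+ k) (2 ℕ.+ j)) n ∎
  where
  s = sgn n
  a₁ = G j (2 ℕ.+ k) n
  b₁ = G (1 ℕ.+ j) (1 ℕ.+ k) n
  c₁ = G (2 ℕ.+ j) k n
  d₁ = (y* G (1 ℕ.+ k) (1 ℕ.+ j)) n
  a₂ = G (1 ℕ.+ k) (2 ℕ.+ j) n
  b₂ = G (2 ℕ.+ k) (1 ℕ.+ j) n
  c₂ = G (3 ℕ.+ k) j n
  d₂ = (y* G (1 ℕ.+ j) (2 ℕ.+ k)) n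
  a₃ = G k (3 ℕ.+ j) n
  d₃ = (y* G (2 ℕ.+ j) (1 ℕ.+ k)) n
  lemma : ∀ s a₁ c₁ a₂ c₂ a₃ b₂ → (a₁ - s * c₂ + s * b₂) + (c₁ - s * a₂ + s * a₃)
    ≡ (a₁ + c₁) - s * (a₂ + c₂) + s * (a₃ + b₂)
  lemma = solve-∀
  lemma′ : ∀ s b₁ d₁ b₂ d₂ a₂ d₃ → (b₁ + b₁ + d₁) - s * (b₂ + b₂ + d₂) + s * (a₂ + a₂ + d₃)
    ≡ (b₁ - s * b₂ + s * a₂) + (b₁ - s * b₂ + s * a₂) + (d₁ + s * d₃ - s * d₂)
  lemma′ = solve-∀

-- The linear system solved by the cofactors

-- A row of `T m` applied to `f`, where i = m - a for row a. In terms of i, differencing rows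
-- becomes recursion.
∑-ramp : ℕ → ℕ → (ℕ → ℤ) → ℤ
∑-ramp m i f = ∑ m λ b → + (i ∸ b) * f b

∑-ramp-zero : ∀ m f → ∑-ramp m 0 f ≡ 0ℤ
∑-ramp-zero m f = ∑-zero m λ b →
  trans (cong (λ z → + z * f b) (ℕ.0∸n≡0 b)) (ℤ.*-zeroˡ (f b))

∑-ramp-one : ∀ m f → ∑-ramp (suc m) 1 f ≡ f 0
∑-ramp-one m f = trans (cong₂ _+_ (ℤ.*-identityˡ (f 0)) (∑-ramp-zero m (f ∘ suc))) (ℤ.+-identityʳ (f 0))

-- The second difference of i ↦ (i - b)⁺ is the indicator of b = i + 1; the bound keeps that index
-- inside the sum.
∑-ramp-second-difference : ∀ m i f → suc i < m →
  ∑-ramp m (2 ℕ.+ i) f + ∑-ramp m i f ≡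
    ∑-ramp m (1 ℕ.+ i) f + ∑-ramp m (1 ℕ.+ i) f + f (suc i)
∑-ramp-second-difference (suc (suc m)) zero    f _   = begin
  + 2 * f 0 + ∑-ramp (suc m) 1 (f ∘ suc) + ∑-ramp (suc (suc m)) 0 f
    ≡⟨ cong₂ (λ u v → + 2 * f 0 + u + v) (∑-ramp-one m (f ∘ suc)) (∑-ramp-zero (suc (suc m)) f) ⟩
  + 2 * f 0 + f 1 + 0ℤ
    ≡⟨ lemma (f 0) (f 1) ⟩
  f 0 + f 0 + f 1
    ≡⟨ cong (λ z → z + z + f 1) (∑-ramp-one (suc m) f) ⟨
  ∑-ramp (suc (suc m)) 1 f + ∑-ramp (suc (suc m)) 1 f + f 1 ∎
  where
  lemma : ∀ a b → + 2 * a + b + 0ℤ ≡ a + a + b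
  lemma = solve-∀
∑-ramp-second-difference (suc zero)    zero    f (s≤s ())
∑-ramp-second-difference (suc m)       (suc i) f i<m = begin
  + (3 ℕ.+ i) * f 0 + ∑-ramp m (2 ℕ.+ i) (f ∘ suc) + (+ (1 ℕ.+ i) * f 0 + ∑-ramp m i (f ∘ suc))
    ≡⟨ lemma (+ i) (f 0) _ _ ⟩
  (+ (2 ℕ.+ i) * f 0 + + (2 ℕ.+ i) * f 0) + (∑-ramp m (2 ℕ.+ i) (f ∘ suc) + ∑-ramp m i (f ∘ suc))
    ≡⟨ cong (_+_ (+ (2 ℕ.+ i) * f 0 + + (2 ℕ.+ i) * f 0))
         (∑-ramp-second-difference m i (f ∘ suc) (s<s⁻¹ i<m)) ⟩
  (+ (2 ℕ.+ i) * f 0 + + (2 ℕ.+ i) * f 0) + (S + S + f (2 ℕ.+ i))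
    ≡⟨ lemma′ (+ (2 ℕ.+ i) * f 0) S (f (2 ℕ.+ i)) ⟩
  (+ (2 ℕ.+ i) * f 0 + S) + (+ (2 ℕ.+ i) * f 0 + S) + f (2 ℕ.+ i) ∎
  where
  S = ∑-ramp m (1 ℕ.+ i) (f ∘ suc)
  lemma : ∀ n a b c → (+ 3 + n) * a + b + ((1ℤ + n) * a + c) ≡ ((+ 2 + n) * a + (+ 2 + n) * a) + (b + c)
  lemma = solve-∀
  lemma′ : ∀ a b c → (a + a) + (b + b + c) ≡ (a + b) + (a + b) + c
  lemma′ = solve-∀

-- For m = s + 1 this counts the pairs of loop labels at a vertex between cycle labels a and b;
-- truncation gives 0 when a + b > s.
T : ℕ → ℕ → ℕ → ℤ
T m a b = + (m ∸ (a ℕ.+ b))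

-- The column of index 0 of the adjugate of 1 − y T, whose determinant is
-- r (2 + m).
cofactor : ℕ → ℕ → Series
cofactor m zero    = r m
cofactor m (suc a) = G (m ∸ suc a) (suc a)

-- Along i + a = m both sides satisfy the same second-order difference equation in i, and they agree
-- at i = 0 and i = 1. The middle term of `G-second-difference` is y times `cofactor m (suc i)`,
-- which matches the term produced by the ramp.
G-ramp : ∀ m i a → i ℕ.+ a ≡ m → G i a ≗ y* (λ n → ∑-ramp m i (λ b → cofactor m b n))
G-ramp m zero          a _    zero    = refl
G-ramp m zero          a _    (suc n) = sym (∑-ramp-zero m (λ b → cofactor m b n))
G-ramp m (suc zero)    a refl n       = trans (G-left a n)
  (y*-cong (λ k → sym (∑-ramp-one a (λ b → cofactor m b k))) n)
G-ramp m (suc (suc i)) a refl n       = begin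
  G (2 ℕ.+ i) a n
    ≡⟨ lemma (G (2 ℕ.+ i) a n) (G i (2 ℕ.+ a) n) ⟩
  G i (2 ℕ.+ a) n + G (2 ℕ.+ i) a n - G i (2 ℕ.+ a) n
    ≡⟨ cong₂ _-_ (G-second-difference i a n) (G-ramp m i (2 ℕ.+ a) m≡₂ n) ⟩
  G (1 ℕ.+ i) (1 ℕ.+ a) n + G (1 ℕ.+ i) (1 ℕ.+ a) n + (y* G (1 ℕ.+ a) (1 ℕ.+ i)) n - (y* S i) n
    ≡⟨ cong₂ (λ u v → u + u + v - (y* S i) n) (G-ramp m (suc i) (suc a) m≡₁ n) (y*-cong mid n) ⟩
  (y* S (1 ℕ.+ i)) n + (y* S (1 ℕ.+ i)) n + (y* cofactor m (suc i)) n - (y* S i) n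
    ≡⟨ y*-step n ⟩
  (y* S (2 ℕ.+ i)) n ∎
  where
  S : ℕ → Series
  S j n = ∑-ramp m j (λ b → cofactor m b n)
  m≡₁ : (1 ℕ.+ i) ℕ.+ (1 ℕ.+ a) ≡ m
  m≡₁ = cong suc (ℕ.+-suc i a)
  m≡₂ : i ℕ.+ (2 ℕ.+ a) ≡ m
  m≡₂ = trans (ℕ.+-suc i (suc a)) m≡₁
  mid : G (1 ℕ.+ a) (1 ℕ.+ i) ≗ cofactor m (suc i)
  mid n = cong (λ z → G z (1 ℕ.+ i) n) (sym (trans (cong (_∸ suc i) (sym m≡₁)) (ℕ.m+n∸m≡n (suc i) (suc a))))
  lemma : ∀ a b → a ≡ b + a - b
  lemma = solve-∀
  y*-step : ∀ n → (y* S (1 ℕ.+ i)) n + (y* S (1 ℕ.+ i)) n + (y* cofactor m (suc i)) n - (y* S i) n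
    ≡ (y* S (2 ℕ.+ i)) n
  y*-step zero    = refl
  y*-step (suc n) = trans
    (cong (_- S i n) (sym (∑-ramp-second-difference m i (λ b → cofactor m b n) (s≤s (s≤s (ℕ.m≤m+n i a))))))
    (sym (trans (lemma (S (2 ℕ.+ i) n) (S i n)) (cong (_- S i n) (ℤ.+-comm (S i n) _))))

-- `G m 0` is the cofactor minus the determinant; restoring the determinant at index 0 produces the
-- source.
cofactor-act : ∀ m a → a < m →
  cofactor m a ≗ scale (δ a 0) (r (2 ℕ.+ m)) ⊕ y* act (T m) m (cofactor m) a
cofactor-act m a a<m n = begin
  cofactor m a n
    ≡⟨ split a ⟩
  δ a 0 * r (2 ℕ.+ m) n + G (m ∸ a) a n
    ≡⟨ cong (_+_ (δ a 0 * r (2 ℕ.+ m) n)) (trans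
         (G-ramp m (m ∸ a) a (ℕ.m∸n+n≡m (ℕ.<⇒≤ a<m)) n)
         (y*-cong (λ k → ∑-cong m λ b _ → cong (λ z → + z * cofactor m b k) (ℕ.∸-+-assoc m a b)) n)) ⟩
  δ a 0 * r (2 ℕ.+ m) n + (y* act (T m) m (cofactor m) a) n ∎
  where
  split : ∀ a → cofactor m a n ≡ δ a 0 * r (2 ℕ.+ m) n + G (m ∸ a) a n
  split zero    = trans (lemma (r m n) (r (2 ℕ.+ m) n))
    (cong (_+_ (1ℤ * r (2 ℕ.+ m) n)) (sym (G-right m n)))
    where
    lemma : ∀ a b → a ≡ 1ℤ * b + (a - b)
    lemma = solve-∀
  split (suc a) = sym (ℤ.+-identityˡ _)

-- Cramer's rule for the entry (0 , 0) of (1 − y T)⁻¹.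
r⊗walks : ∀ m → r (3 ℕ.+ m) ⊗ walks (T (suc m)) (suc m) 0 0 ≗ r (suc m)
r⊗walks m = act-unique (T (suc m)) (suc m) (λ a → scale (δ a 0) (r (3 ℕ.+ m)))
  (λ a → r (3 ℕ.+ m) ⊗ walks (T (suc m)) (suc m) a 0) (cofactor (suc m))
  (λ a _ → ⊗-walks (T (suc m)) (suc m) (r (3 ℕ.+ m)) a 0)
  (cofactor-act (suc m)) 0 ℕ.z<s

-- The trace by induction on the size

walks-cong : ∀ {w w′} → (∀ a b → w a b ≡ w′ a b) → ∀ m a b → walks w m a b ≗ walks w′ m a b
walks-cong eq m a b zero    = refl
walks-cong eq m a b (suc n) = ∑-cong m λ c _ → cong₂ _*_ (eq a c) (walks-cong eq m c b n)

-- Without index 0, the entries (m + 2 - a - b)⁺ become (m - a - b)⁺ on m + 1 indices, the last of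
-- which has zero row and column.
trace-shift : ∀ m → trace (shift (T (2 ℕ.+ m))) (suc m) ≗ trace (T m) m ⊕ const 1ℤ
trace-shift m n = trans
  (∑-cong (suc m) λ a _ → walks-cong (λ a b → cong (λ z → + (suc m ∸ z)) (ℕ.+-suc a b)) (suc m) a a n)
  (trace-isolated (T m) m
    (λ a → cong +_ (ℕ.m≤n⇒m∸n≡0 (ℕ.m≤n+m m a)))
    (λ b → cong +_ (ℕ.m≤n⇒m∸n≡0 (ℕ.m≤m+n m b))) n)

-- This is F = m - θq / q cleared of denominators. Since p = q / q″, one has θp / p = θq / q - θq″ /
-- q″, so growing the size by 2 adds 1 + 1 + θp / p and replaces q by q″.
trace⊗r : ∀ m → trace (T m) m ⊗ r (2 ℕ.+ m) ≗ scale (+ m) (r (2 ℕ.+ m)) ⊕ scale -1ℤ (θ (r (2 ℕ.+ m)))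
trace⊗r zero n = trans (⊗-constʳ (trace (T 0) 0) 1ℤ n) (rhs n)
  where
  rhs : ∀ n → 0ℤ ≡ 0ℤ * r 2 n + -1ℤ * (+ n * r 2 n)
  rhs zero    = refl
  rhs (suc n) = sym (cong (λ z → 0ℤ + -1ℤ * z) (ℤ.*-zeroʳ (+ suc n)))
trace⊗r (suc zero) n = begin
  (trace (T 1) 1 ⊗ r 3) n
    ≡⟨ ⊗-cong (λ k → ℤ.+-identityʳ (walks (T 1) 1 0 0 k)) (λ _ → refl) n ⟩
  (walks (T 1) 1 0 0 ⊗ r 3) n
    ≡⟨ ⊗-comm (walks (T 1) 1 0 0) (r 3) n ⟩
  (r 3 ⊗ walks (T 1) 1 0 0) n
    ≡⟨ r⊗walks 0 n ⟩
  r 1 n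
    ≡⟨ rhs n ⟩
  1ℤ * r 3 n + -1ℤ * (+ n * r 3 n) ∎
  where
  rhs : ∀ n → r 1 n ≡ 1ℤ * r 3 n + -1ℤ * (+ n * r 3 n)
  rhs zero          = refl
  rhs (suc zero)    = refl
  rhs (suc (suc n)) = sym (cong (λ z → 0ℤ + -1ℤ * z) (ℤ.*-zeroʳ (+ (2 ℕ.+ n))))
-- The constant term of `p` is `δ 0 0`, which computes to 1.
trace⊗r (suc (suc m)) = ⊗-cancelˡ p _ _ refl λ n → begin
  (p ⊗ (F″ ⊗ q″)) n
    ≡⟨ ⊗-assoc p F″ q″ n ⟨
  ((p ⊗ F″) ⊗ q″) n
    ≡⟨ ⊗-cong step (λ _ → refl) n ⟩
  (((p ⊗ F ⊕ p) ⊕ (p ⊕ θ p)) ⊗ q″) n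
    ≡⟨ trans (⊗-distribʳ q″ (p ⊗ F ⊕ p) (p ⊕ θ p) n)
         (cong₂ _+_ (⊗-distribʳ q″ (p ⊗ F) p n) (⊗-distribʳ q″ p (θ p) n)) ⟩
  ((p ⊗ F) ⊗ q″) n + (p ⊗ q″) n + ((p ⊗ q″) n + (θ p ⊗ q″) n)
    ≡⟨ cong (λ z → z + (p ⊗ q″) n + ((p ⊗ q″) n + (θ p ⊗ q″) n)) (trans (outer n) (trace⊗r m n)) ⟩
  + m * q n + -1ℤ * (+ n * q n) + (p ⊗ q″) n + ((p ⊗ q″) n + (θ p ⊗ q″) n)
    -- Writing q as `p ⊗ q″` lets the Leibniz rule split θq; its `θ p ⊗ q″` cancels the one coming
    -- from the cuts at 0.
    ≡⟨ cong (λ z → + m * z + -1ℤ * (+ n * z) + (p ⊗ q″) n + ((p ⊗ q″) n + (θ p ⊗ q″) n)) (p⊗q″ n) ⟨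
  + m * (p ⊗ q″) n + -1ℤ * (+ n * (p ⊗ q″) n) + (p ⊗ q″) n + ((p ⊗ q″) n + (θ p ⊗ q″) n)
    ≡⟨ cong (λ z → + m * (p ⊗ q″) n + -1ℤ * z + (p ⊗ q″) n + ((p ⊗ q″) n + (θ p ⊗ q″) n)) (θ-⊗ p q″ n) ⟩
  + m * (p ⊗ q″) n + -1ℤ * ((θ p ⊗ q″) n + (p ⊗ θ q″) n) + (p ⊗ q″) n + ((p ⊗ q″) n + (θ p ⊗ q″) n)
    ≡⟨ lemma (+ m) ((p ⊗ q″) n) ((θ p ⊗ q″) n) ((p ⊗ θ q″) n) ⟩
  + (2 ℕ.+ m) * (p ⊗ q″) n + -1ℤ * (p ⊗ θ q″) n
    ≡⟨ cong₂ _+_ (⊗-scaleʳ (+ (2 ℕ.+ m)) p q″ n) (⊗-scaleʳ -1ℤ p (θ q″) n) ⟨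
  (p ⊗ scale (+ (2 ℕ.+ m)) q″) n + (p ⊗ scale -1ℤ (θ q″)) n
    ≡⟨ ⊗-distribˡ p (scale (+ (2 ℕ.+ m)) q″) (scale -1ℤ (θ q″)) n ⟨
  (p ⊗ (scale (+ (2 ℕ.+ m)) q″ ⊕ scale -1ℤ (θ q″))) n ∎
  where
  p = walks (T (2 ℕ.+ m)) (2 ℕ.+ m) 0 0
  F = trace (T m) m
  F″ = trace (T (2 ℕ.+ m)) (2 ℕ.+ m)
  q = r (2 ℕ.+ m)
  q″ = r (4 ℕ.+ m)

  p⊗q″ : p ⊗ q″ ≗ q
  p⊗q″ n = trans (⊗-comm p q″ n) (r⊗walks (suc m) n)

  step : p ⊗ F″ ≗ (p ⊗ F ⊕ p) ⊕ (p ⊕ θ p)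
  step n = trans (trace-through-0 (T (2 ℕ.+ m)) (suc m) n) (cong (_+ (p n + θ p n))
    (trans (⊗-cong (λ _ → refl) (trace-shift m) n)
      (trans (⊗-distribˡ p F (const 1ℤ) n)
        (cong (_+_ ((p ⊗ F) n)) (trans (⊗-constʳ p 1ℤ n) (ℤ.*-identityʳ (p n)))))))

  outer : (p ⊗ F) ⊗ q″ ≗ F ⊗ q
  outer n = trans (⊗-cong (⊗-comm p F) (λ _ → refl) n)
    (trans (⊗-assoc F p q″ n) (⊗-cong (λ _ → refl) p⊗q″ n))

  lemma : ∀ m a b c → m * a + -1ℤ * (b + c) + a + (a + b) ≡ (+ 2 + m) * a + -1ℤ * c
  lemma = solve-∀

-- Counting magic labellings

-- Indexing by positions makes the lemmas on finite sums applicable, exchange of sums included.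
∑ᴸ : ∀ {A : Set} → List A → (A → ℤ) → ℤ
∑ᴸ xs f = sum (f ∘ List.lookup xs)

∑ᴸ-cong : ∀ {A : Set} (xs : List A) {f g} → f ≗ g → ∑ᴸ xs f ≡ ∑ᴸ xs g
∑ᴸ-cong xs eq = sum-cong-≗ (eq ∘ List.lookup xs)

∑ᴸ-++ : ∀ {A : Set} (xs ys : List A) f → ∑ᴸ (xs List.++ ys) f ≡ ∑ᴸ xs f + ∑ᴸ ys f
∑ᴸ-++ []       ys f = sym (ℤ.+-identityˡ _)
∑ᴸ-++ (x ∷ xs) ys f = trans (cong (_+_ (f x)) (∑ᴸ-++ xs ys f)) (sym (ℤ.+-assoc (f x) _ _))

∑ᴸ-map : ∀ {A B : Set} (g : A → B) xs f → ∑ᴸ (List.map g xs) f ≡ ∑ᴸ xs (f ∘ g)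
∑ᴸ-map g []       f = refl
∑ᴸ-map g (x ∷ xs) f = cong (_+_ (f (g x))) (∑ᴸ-map g xs f)

∑ᴸ-cartesianProductWith : ∀ {A B C : Set} (g : A → B → C) xs ys f →
  ∑ᴸ (cartesianProductWith g xs ys) f ≡ ∑ᴸ xs λ x → ∑ᴸ ys λ y → f (g x y)
∑ᴸ-cartesianProductWith g []       ys f = refl
∑ᴸ-cartesianProductWith g (x ∷ xs) ys f = trans
  (∑ᴸ-++ (List.map (g x) ys) (cartesianProductWith g xs ys) f)
  (cong₂ _+_ (∑ᴸ-map (g x) ys f) (∑ᴸ-cartesianProductWith g xs ys f))

∑ᴸ-applyUpTo : ∀ {A : Set} (g : ℕ → A) m f → ∑ᴸ (applyUpTo g m) f ≡ ∑ m (f ∘ g)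
∑ᴸ-applyUpTo g zero    f = refl
∑ᴸ-applyUpTo g (suc m) f = cong (_+_ (f (g 0))) (∑ᴸ-applyUpTo (g ∘ suc) m f)

indicator : ∀ {P : Set} → Dec P → ℤ
indicator d = if does d then 1ℤ else 0ℤ

length-filter : ∀ {A : Set} {P : A → Set} (P? : Decidable P) xs →
  + length (filter P? xs) ≡ ∑ᴸ xs (indicator ∘ P?)
length-filter P? []       = refl
length-filter P? (x ∷ xs) with does (P? x)
... | true  = cong (_+_ 1ℤ) (length-filter P? xs)
... | false = trans (length-filter P? xs) (sym (ℤ.+-identityˡ _))

∏ : ∀ n → (Fin n → ℤ) → ℤ
∏ zero    f = 1ℤ
∏ (suc n) f = f zero * ∏ n (f ∘ suc)

∏-cong : ∀ n {f g} → f ≗ g → ∏ n f ≡ ∏ n g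
∏-cong zero    eq = refl
∏-cong (suc n) eq = cong₂ _*_ (eq zero) (∏-cong n (eq ∘ suc))

-- The Boolean of a decision depends only on the proposition, so `does-⇔` replaces an arbitrary `d`
-- by a test of the head and a test of the tail.
indicator-all : ∀ n {f : Fin n → ℕ} {s} (d : Dec (∀ i → f i ≡ s)) →
  indicator d ≡ ∏ n λ i → δ (f i) s
indicator-all zero    d = cong (if_then 1ℤ else 0ℤ) (dec-true d λ ())
indicator-all (suc n) {f} {s} d = begin
  indicator d
    ≡⟨ cong (if_then 1ℤ else 0ℤ) (does-⇔
         (mk⇔ (λ p → p zero , p ∘ suc) (λ { (p , q) zero → p ; (p , q) (suc i) → q i }))
         d ((f zero ℕ.≟ s) ×-dec rest)) ⟩
  (if (f zero ℕ.≡ᵇ s) ∧ does rest then 1ℤ else 0ℤ)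
    ≡⟨ if-∧ (f zero ℕ.≡ᵇ s) (does rest) ⟩
  δ (f zero) s * indicator rest
    ≡⟨ cong (_*_ (δ (f zero) s)) (indicator-all n rest) ⟩
  δ (f zero) s * ∏ n (λ i → δ (f (suc i)) s) ∎
  where
  rest = Fin.all? λ i → f (suc i) ℕ.≟ s
  if-∧ : ∀ a b → (if a ∧ b then 1ℤ else 0ℤ) ≡ (if a then 1ℤ else 0ℤ) * (if b then 1ℤ else 0ℤ)
  if-∧ true  b = sym (ℤ.*-identityˡ _)
  if-∧ false b = refl

-- The only candidate is y = t - d; it exists when d ≤ t, and t < m puts it in range.
∑-δ-+ : ∀ m d t → t < m → ∑ m (λ y → δ (d ℕ.+ y) t) ≡ (if d ℕ.<ᵇ suc t then 1ℤ else 0ℤ)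
∑-δ-+ (suc m) zero    zero    _   = cong (_+_ 1ℤ) (∑-zero m λ _ → refl)
∑-δ-+ (suc m) zero    (suc t) t<m = trans (ℤ.+-identityˡ _) (∑-δ-+ m 0 t (s<s⁻¹ t<m))
∑-δ-+ m       (suc d) zero    _   = ∑-zero m λ _ → refl
∑-δ-+ m       (suc d) (suc t) t<m = ∑-δ-+ m d t (ℕ.<-trans (ℕ.n<1+n t) t<m)

∑-< : ∀ m t → t ℕ.≤ m → ∑ m (λ x → if x ℕ.<ᵇ t then 1ℤ else 0ℤ) ≡ + t
∑-< m       zero    _   = ∑-zero m λ _ → refl
∑-< (suc m) (suc t) t≤m = cong (_+_ 1ℤ) (∑-< m t (ℕ.s≤s⁻¹ t≤m))

∑-+-< : ∀ m c t → t < m → ∑ m (λ x → if c ℕ.+ x ℕ.<ᵇ suc t then 1ℤ else 0ℤ) ≡ + (suc t ∸ c)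
∑-+-< m zero    t       t<m = ∑-< m (suc t) t<m
∑-+-< m (suc c) zero    _   = trans (∑-zero m λ _ → refl) (cong +_ (sym (ℕ.0∸n≡0 c)))
∑-+-< m (suc c) (suc t) t<m = ∑-+-< m c t (ℕ.<-trans (ℕ.n<1+n t) t<m)

-- The first loop label x determines the second, so what is counted are the x with b + c + x ≤ s.
loop-labels : ∀ s b c →
  ∑ᴸ (upTo (suc s)) (λ x → ∑ᴸ (upTo (suc s)) λ y → δ (b ℕ.+ x ℕ.+ y ℕ.+ c) s) ≡ T (suc s) b c
loop-labels s b c = begin
  ∑ᴸ (upTo (suc s)) (λ x → ∑ᴸ (upTo (suc s)) λ y → δ (b ℕ.+ x ℕ.+ y ℕ.+ c) s)
    ≡⟨ ∑ᴸ-applyUpTo (λ x → x) (suc s) (λ x → ∑ᴸ (upTo (suc s)) λ y → δ (b ℕ.+ x ℕ.+ y ℕ.+ c) s) ⟩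
  ∑ (suc s) (λ x → ∑ᴸ (upTo (suc s)) λ y → δ (b ℕ.+ x ℕ.+ y ℕ.+ c) s)
    ≡⟨ ∑-cong (suc s) (λ x _ → inner x) ⟩
  ∑ (suc s) (λ x → if b ℕ.+ c ℕ.+ x ℕ.<ᵇ suc s then 1ℤ else 0ℤ)
    ≡⟨ ∑-+-< (suc s) (b ℕ.+ c) s (ℕ.n<1+n s) ⟩
  T (suc s) b c ∎
  where
  rearrange : ∀ b x y c → b ℕ.+ x ℕ.+ y ℕ.+ c ≡ b ℕ.+ c ℕ.+ x ℕ.+ y
  rearrange = ℕ-Solver.solve-∀
  inner : ∀ x → ∑ᴸ (upTo (suc s)) (λ y → δ (b ℕ.+ x ℕ.+ y ℕ.+ c) s) ≡
    (if b ℕ.+ c ℕ.+ x ℕ.<ᵇ suc s then 1ℤ else 0ℤ)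
  inner x = begin
    ∑ᴸ (upTo (suc s)) (λ y → δ (b ℕ.+ x ℕ.+ y ℕ.+ c) s)
      ≡⟨ ∑ᴸ-applyUpTo (λ y → y) (suc s) (λ y → δ (b ℕ.+ x ℕ.+ y ℕ.+ c) s) ⟩
    ∑ (suc s) (λ y → δ (b ℕ.+ x ℕ.+ y ℕ.+ c) s)
      ≡⟨ ∑-cong (suc s) (λ y _ → cong (λ z → δ z s) (rearrange b x y c)) ⟩
    ∑ (suc s) (λ y → δ (b ℕ.+ c ℕ.+ x ℕ.+ y) s)
      ≡⟨ ∑-δ-+ (suc s) (b ℕ.+ c ℕ.+ x) s (ℕ.n<1+n s) ⟩
    (if b ℕ.+ c ℕ.+ x ℕ.<ᵇ suc s then 1ℤ else 0ℤ) ∎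

vertexSum : ∀ {n} → Vec ℕ n → Vec ℕ n → Vec ℕ n → Vec ℕ n → Fin n → ℕ
vertexSum β γ α₁ α₂ i = lookup β i ℕ.+ lookup α₁ i ℕ.+ lookup α₂ i ℕ.+ lookup γ i

-- Keeping the following cycle labels `γ` independent of `β` lets the induction drop a vertex
-- without closing up the cycle.
all-loop-labels : ∀ s n (β γ : Vec ℕ n) → let vs = vecs (upTo (suc s)) n in
  ∑ᴸ vs (λ α₁ → ∑ᴸ vs λ α₂ → ∏ n λ i → δ (vertexSum β γ α₁ α₂ i) s) ≡
  ∏ n λ i → T (suc s) (lookup β i) (lookup γ i)
all-loop-labels s zero    []      []      = refl
all-loop-labels s (suc n) (b ∷ β) (c ∷ γ) = begin
  ∑ᴸ (vecs xs (suc n)) (λ α₁ → ∑ᴸ (vecs xs (suc n)) λ α₂ → ∏ (suc n) (f α₁ α₂))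
    ≡⟨ ∑ᴸ-cartesianProductWith _∷_ xs vs (λ α₁ → ∑ᴸ (vecs xs (suc n)) λ α₂ → ∏ (suc n) (f α₁ α₂)) ⟩
  ∑ᴸ xs (λ x → ∑ᴸ vs λ α₁ → ∑ᴸ (vecs xs (suc n)) λ α₂ → ∏ (suc n) (f (x ∷ α₁) α₂))
    ≡⟨ ∑ᴸ-cong xs (λ x → ∑ᴸ-cong vs λ α₁ →
         ∑ᴸ-cartesianProductWith _∷_ xs vs (λ α₂ → ∏ (suc n) (f (x ∷ α₁) α₂))) ⟩
  ∑ᴸ xs (λ x → ∑ᴸ vs λ α₁ → ∑ᴸ xs λ y → ∑ᴸ vs λ α₂ → g x y * ∏ n (k α₁ α₂))
    -- Both loop labels of the first vertex move outside, and the sum factors.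
    ≡⟨ ∑ᴸ-cong xs (λ x → ∑-comm {length vs} {length xs} λ i j →
         ∑ᴸ vs λ α₂ → g x (List.lookup xs j) * ∏ n (k (List.lookup vs i) α₂)) ⟩
  ∑ᴸ xs (λ x → ∑ᴸ xs λ y → ∑ᴸ vs λ α₁ → ∑ᴸ vs λ α₂ → g x y * ∏ n (k α₁ α₂))
    ≡⟨ ∑ᴸ-cong xs (λ x → ∑ᴸ-cong xs λ y → factor (g x y)) ⟩
  ∑ᴸ xs (λ x → ∑ᴸ xs λ y → g x y * P)
    ≡⟨ ∑ᴸ-cong xs (λ x → *-distribʳ-sum P (λ j → g x (List.lookup xs j))) ⟨
  ∑ᴸ xs (λ x → (∑ᴸ xs λ y → g x y) * P)
    ≡⟨ *-distribʳ-sum P (λ i → ∑ᴸ xs (g (List.lookup xs i))) ⟨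
  ∑ᴸ xs (λ x → ∑ᴸ xs λ y → g x y) * P
    ≡⟨ cong (_* P) (loop-labels s b c) ⟩
  T (suc s) b c * P ∎
  where
  xs = upTo (suc s)
  vs = vecs xs n
  f = λ α₁ α₂ i → δ (vertexSum (b ∷ β) (c ∷ γ) α₁ α₂ i) s
  k = λ α₁ α₂ i → δ (vertexSum β γ α₁ α₂ i) s
  g = λ x y → δ (b ℕ.+ x ℕ.+ y ℕ.+ c) s
  P = ∏ n λ i → T (suc s) (lookup β i) (lookup γ i)
  factor : ∀ z → ∑ᴸ vs (λ α₁ → ∑ᴸ vs λ α₂ → z * ∏ n (k α₁ α₂)) ≡ z * P
  factor z = begin
    ∑ᴸ vs (λ α₁ → ∑ᴸ vs λ α₂ → z * ∏ n (k α₁ α₂))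
      ≡⟨ ∑ᴸ-cong vs (λ α₁ → *-distribˡ-sum z (λ j → ∏ n (k α₁ (List.lookup vs j)))) ⟨
    ∑ᴸ vs (λ α₁ → z * (∑ᴸ vs λ α₂ → ∏ n (k α₁ α₂)))
      ≡⟨ *-distribˡ-sum z (λ i → ∑ᴸ vs λ α₂ → ∏ n (k (List.lookup vs i) α₂)) ⟨
    z * ∑ᴸ vs (λ α₁ → ∑ᴸ vs λ α₂ → ∏ n (k α₁ α₂))
      ≡⟨ cong (_*_ z) (all-loop-labels s n β γ) ⟩
    z * P ∎

-- `v` lists the interior vertices of a walk from `a` to `b`, so step i goes from position i of
-- `a ∷ v` to position i of `v ∷ʳ b`.
∑-vecs : ∀ w m k a b → b < m →
  ∑ᴸ (vecs (upTo m) k) (λ v → ∏ (suc k) λ i → w (lookup (a ∷ v) i) (lookup (v ∷ʳ b) i)) ≡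
  walks w m a b (suc k)
∑-vecs w m zero    a b b<m = begin
  w a b * 1ℤ + 0ℤ                    ≡⟨ trans (ℤ.+-identityʳ _) (ℤ.*-identityʳ _) ⟩
  w a b                              ≡⟨ ∑-δ m b (w a) b<m ⟨
  ∑ m (λ c → δ b c * w a c)          ≡⟨ ∑-cong m (λ c _ → trans (ℤ.*-comm (δ b c) (w a c))
                                          (cong (_*_ (w a c)) (δ-sym b c))) ⟩
  ∑ m (λ c → w a c * δ c b)          ∎
∑-vecs w m (suc k) a b b<m = begin
  ∑ᴸ (vecs (upTo m) (suc k)) (λ v → ∏ (2 ℕ.+ k) (f a v))
    ≡⟨ ∑ᴸ-cartesianProductWith _∷_ (upTo m) vs (λ v → ∏ (2 ℕ.+ k) (f a v)) ⟩
  ∑ᴸ (upTo m) (λ c → ∑ᴸ vs λ v → w a c * ∏ (suc k) (f c v))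
    ≡⟨ ∑ᴸ-applyUpTo (λ c → c) m (λ c → ∑ᴸ vs λ v → w a c * ∏ (suc k) (f c v)) ⟩
  ∑ m (λ c → ∑ᴸ vs λ v → w a c * ∏ (suc k) (f c v))
    ≡⟨ ∑-cong m (λ c _ → trans (sym (*-distribˡ-sum (w a c) (λ j → ∏ (suc k) (f c (List.lookup vs j)))))
         (cong (_*_ (w a c)) (∑-vecs w m k c b b<m))) ⟩
  ∑ m (λ c → w a c * walks w m c b (suc k)) ∎
  where
  vs = vecs (upTo m) k
  f : ∀ {n} → ℕ → Vec ℕ n → Fin (suc n) → ℤ
  f a v i = w (lookup (a ∷ v) i) (lookup (v ∷ʳ b) i)

lookup-∷ʳ-fromℕ : ∀ {n} (v : Vec ℕ n) b → lookup (v ∷ʳ b) (fromℕ n) ≡ b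
lookup-∷ʳ-fromℕ []      b = refl
lookup-∷ʳ-fromℕ (x ∷ v) b = lookup-∷ʳ-fromℕ v b

lookup-∷ʳ-inject₁ : ∀ {n} (v : Vec ℕ n) b i → lookup (v ∷ʳ b) (inject₁ i) ≡ lookup v i
lookup-∷ʳ-inject₁ (x ∷ v) b zero    = refl
lookup-∷ʳ-inject₁ (x ∷ v) b (suc i) = lookup-∷ʳ-inject₁ v b i

-- `v ∷ʳ b` is `b ∷ v` rotated by one place. Only the last index wraps around, hence the case split.
lookup-next : ∀ {n} b (v : Vec ℕ n) i → lookup (b ∷ v) (next (suc n) i) ≡ lookup (v ∷ʳ b) i
lookup-next {n} b v i with view i
... | ‵fromℕ     = trans (cong (lookup (b ∷ v)) (Fin.toℕ-injective {j = zero} (begin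
  toℕ (next (suc n) (fromℕ n))     ≡⟨ Fin.toℕ-fromℕ< _ ⟩
  suc (toℕ (fromℕ n)) ℕ.% suc n    ≡⟨ cong (λ z → suc z ℕ.% suc n) (Fin.toℕ-fromℕ n) ⟩
  suc n ℕ.% suc n                  ≡⟨ n%n≡0 (suc n) ⟩
  0                                ∎))) (sym (lookup-∷ʳ-fromℕ v b))
... | ‵inject₁ j = trans (cong (lookup (b ∷ v)) (Fin.toℕ-injective {j = suc j} (begin
  toℕ (next (suc n) (inject₁ j))     ≡⟨ Fin.toℕ-fromℕ< _ ⟩
  suc (toℕ (inject₁ j)) ℕ.% suc n    ≡⟨ cong (λ z → suc z ℕ.% suc n) (Fin.toℕ-inject₁ j) ⟩
  suc (toℕ j) ℕ.% suc n              ≡⟨ m<n⇒m%n≡m (s≤s (Fin.toℕ<n j)) ⟩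
  suc (toℕ j)                        ∎))) (sym (lookup-∷ʳ-inject₁ v b j))

FC₂≗trace : ∀ s → FC₂ s ≗ trace (T (suc s)) (suc s)
-- The convention at n = 0 is the trace of the identity matrix of size s + 1.
FC₂≗trace s zero    = sym (∑-δ-refl (suc s))
  where
  ∑-δ-refl : ∀ m → ∑ m (λ a → δ a a) ≡ + m
  ∑-δ-refl zero    = refl
  ∑-δ-refl (suc m) = cong (_+_ 1ℤ) (∑-δ-refl m)
FC₂≗trace s (suc k) = begin
  + length (magicLabellings (suc k) s)
    ≡⟨ length-filter (isMagic? (suc k) s) (labellingsUpTo s (suc k)) ⟩
  ∑ᴸ (labellingsUpTo s (suc k)) (indicator ∘ isMagic? (suc k) s)
    ≡⟨ ∑ᴸ-cartesianProductWith _,_ vs (cartesianProduct vs vs) (indicator ∘ isMagic? (suc k) s) ⟩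
  ∑ᴸ vs (λ β → ∑ᴸ (cartesianProduct vs vs) λ α → indicator (isMagic? (suc k) s (β , α)))
    ≡⟨ ∑ᴸ-cong vs (λ β → ∑ᴸ-cartesianProductWith _,_ vs vs (λ α → indicator (isMagic? (suc k) s (β , α)))) ⟩
  ∑ᴸ vs (λ β → ∑ᴸ vs λ α₁ → ∑ᴸ vs λ α₂ → indicator (isMagic? (suc k) s (β , α₁ , α₂)))
    ≡⟨ ∑ᴸ-cong vs fixed-cycle ⟩
  ∑ᴸ vs cycleWeight
    ≡⟨ ∑ᴸ-cartesianProductWith _∷_ (upTo m) (vecs (upTo m) k) cycleWeight ⟩
  ∑ᴸ (upTo m) (λ b → ∑ᴸ (vecs (upTo m) k) λ v → cycleWeight (b ∷ v))
    ≡⟨ ∑ᴸ-applyUpTo (λ b → b) m (λ b → ∑ᴸ (vecs (upTo m) k) λ v → cycleWeight (b ∷ v)) ⟩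
  ∑ m (λ b → ∑ᴸ (vecs (upTo m) k) λ v → cycleWeight (b ∷ v))
    ≡⟨ ∑-cong m (λ b b<m → ∑-vecs (T m) m k b b b<m) ⟩
  trace (T m) m (suc k) ∎
  where
  m = suc s
  vs = vecs (upTo m) (suc k)
  cycleWeight : Vec ℕ (suc k) → ℤ
  cycleWeight (b ∷ v) = ∏ (suc k) λ i → T m (lookup (b ∷ v) i) (lookup (v ∷ʳ b) i)
  fixed-cycle : ∀ β → ∑ᴸ vs (λ α₁ → ∑ᴸ vs λ α₂ → indicator (isMagic? (suc k) s (β , α₁ , α₂))) ≡ cycleWeight β
  fixed-cycle β@(b ∷ v) = trans
    (∑ᴸ-cong vs λ α₁ → ∑ᴸ-cong vs λ α₂ → trans
      (indicator-all (suc k) (isMagic? (suc k) s (β , α₁ , α₂)))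
      (∏-cong (suc k) λ i → cong (λ z → δ (lookup β i ℕ.+ lookup α₁ i ℕ.+ lookup α₂ i ℕ.+ z) s) (lookup-next b v i)))
    (all-loop-labels s (suc k) β (v ∷ʳ b))

theorem1p4 : (s : ℕ) → .{{_ : NonZero s}} →
    FC₂ s ≗ ⊖ (divide (y* d/dy ⟦ Q s ⟧) ⟦ Q s ⟧ (Q-constant-term s)) ⊕ const (+ suc s)
theorem1p4 s n = begin
  FC₂ s n
    ≡⟨ FC₂≗trace s n ⟩
  F n
    ≡⟨ lemma (c n) (F n) ⟩
  - (c n + -1ℤ * F n) + c n
    -- By uniqueness of the quotient it is enough that (s + 1 - F) q = θq, which is `trace⊗r` at
    -- size s + 1, where `r (3 ℕ.+ s)` is `⟦ Q s ⟧`.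
    ≡⟨ cong (λ z → - z + c n) (divide-unique (c ⊕ scale -1ℤ F) (y* d/dy q) q (Q-constant-term s) eq n) ⟩
  - divide (y* d/dy q) q (Q-constant-term s) n + c n ∎
  where
  q = ⟦ Q s ⟧
  F = trace (T (suc s)) (suc s)
  c = const (+ suc s)
  lemma : ∀ a b → b ≡ - (a + -1ℤ * b) + a
  lemma = solve-∀
  lemma′ : ∀ k a b → a * k + -1ℤ * (k * a + -1ℤ * b) ≡ b
  lemma′ = solve-∀
  eq : (c ⊕ scale -1ℤ F) ⊗ q ≗ y* d/dy q
  eq n = begin
    ((c ⊕ scale -1ℤ F) ⊗ q) n
      ≡⟨ ⊗-distribʳ q c (scale -1ℤ F) n ⟩
    (c ⊗ q) n + (scale -1ℤ F ⊗ q) n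
      ≡⟨ cong₂ _+_ (trans (⊗-comm c q n) (⊗-constʳ q (+ suc s) n)) (⊗-scaleˡ -1ℤ F q n) ⟩
    q n * + suc s + -1ℤ * (F ⊗ q) n
      ≡⟨ cong (λ z → q n * + suc s + -1ℤ * z) (trace⊗r (suc s) n) ⟩
    q n * + suc s + -1ℤ * (+ suc s * q n + -1ℤ * θ q n)
      ≡⟨ lemma′ (+ suc s) (q n) (θ q n) ⟩
    θ q n
      ≡⟨ θ≗y*d/dy q n ⟩
    (y* d/dy q) n ∎
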